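{- Let $\Gamma$ be a distance-regular graph with classical parameters $(D,b,\alpha,\beta)$ such that $b\ge 2$ and $D\ge 3$. Let $s$ be a positive integer and assume $\Gamma$ has the SPLS$(s)$ property. Let $r=[D]$. Assume that (1) $\beta > (b+2)(b+1)(s-1) - (b(b+1)+r-1)\alpha$; (2) $\beta > ((b+1)(b^2+b+1)-2)(s-b) - \alpha(b+1)r + \alpha(b+1)^2$; (3) $\beta > ((b+1)(b^2+b+1)-2+b)(s-b) - \alpha(r-1) + b^2 - b$. Then $\Gamma$ is geometric.
   Context: Distance-regular graph with intersection numbers $b_i,c_i$, valency $k=b_0$, $a_i=k-b_i-c_i$. For integer $b\ne 1$, $[j]=\frac{b^j-1}{b-1}$. Classical parameters $(D,b,\alpha,\beta)$: diameter $D$, $b_i=([D]-[i])(\beta-\alpha[i])$ ($0\le i\le D-1$), $c_i=[i](1+\alpha[i-1])$ ($1\le i\le D$). A partial linear space: points and lines, any two distinct points on at most one common line; point graph: points adjacent iff on a common line. $\tau(X)$: maximum over non-incident point $x$ and line $\ell$ of the number of points of $\ell$ collinear with $x$. For integers $c\ge1,s\ge2$, $\Gamma$ has the SPLS$(c,s)$ property if $\Gamma$ is the point graph of a partial linear space $X=(V(\Gamma),\mathcal L,\in)$ with $\mathcal L$ the set of all maximal cliques with at least $a_1+2-(c-1)(s-1)$ vertices, $a_1\ge(2s-1)(c-1)$, each vertex on at most $s$ lines, and $\tau(X)\le c$; SPLS$(s)$ means SPLS$(c_2,s)$. With $\theta_{\min}$ the smallest adjacency eigenvalue, a Delsarte clique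 is a clique of size $1+\frac{k}{ -\theta_{\min}}$; $\Gamma$ is geometric if there is a set of Delsarte cliques such that every edge lies in exactly one of them. -}

module Defs where

open import Data.Fin using (Fin)
open import Data.Fin.Subset using (Subset; _∈_; _∉_; _⊆_; ∣_∣)
open import Data.Integer as ℤ using (ℤ; +_)
open import Data.List using (List; length)
import Data.List.Membership.Propositional as List
open import Data.List.Relation.Unary.Unique.Propositional using (Unique)
open import Data.Nat as ℕ using (ℕ; suc)
import Data.Nat.Properties as ℕ
open import Data.Product using (Σ; ∃; ∃!; ∃-syntax; _×_; _,_; proj₁; proj₂)
open import Data.Rational as ℚ using (ℚ; 0ℚ; 1ℚ; ½)
import Data.Rational.Properties as ℚ
open import Data.Rational.Solver using (module +-*-Solver)
open import Data.Sum using (_⊎_)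
open import Data.Vec.Functional using (foldr)
open import Function using (_∘_; _⇔_)
open import Level using (0ℓ)
open import Relation.Binary using (Rel; Decidable; Symmetric; Irreflexive)
open import Relation.Binary.PropositionalEquality
  using (_≡_; _≢_; refl; sym; trans; cong; cong₂; subst)
open import Relation.Nullary using (¬_; yes; no)

-- Reals are Cauchy sequences of rationals, taken up to _≈_ below.
IsCauchy : (ℕ → ℚ) → Set
IsCauchy x =
  ∀ ε → 0ℚ ℚ.< ε → ∃[ N ] ∀ m n → N ℕ.≤ m → N ℕ.≤ n → ℚ.∣ x m ℚ.- x n ∣ ℚ.≤ ε

record ℝ : Set where
  constructor mkℝ
  field
    seq    : ℕ → ℚ
    cauchy : IsCauchy seq

open ℝ public

private
  abstract
    0<ε*½ : ∀ {ε} → 0ℚ ℚ.< ε → 0ℚ ℚ.< ε ℚ.* ½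
    0<ε*½ {ε} 0<ε = subst (ℚ._< ε ℚ.* ½) (ℚ.*-zeroˡ ½) (ℚ.*-monoˡ-<-pos ½ 0<ε)

    halves : ∀ ε → ε ℚ.* ½ ℚ.+ ε ℚ.* ½ ≡ ε
    halves ε = trans (sym (ℚ.*-distribˡ-+ ε ½ ½)) (ℚ.*-identityʳ ε)

    const-cauchy : ∀ q → IsCauchy (λ _ → q)
    const-cauchy q ε 0<ε =
      0 , λ _ _ _ _ → subst (λ z → ℚ.∣ z ∣ ℚ.≤ ε) (sym (ℚ.+-inverseʳ q)) (ℚ.<⇒≤ 0<ε)

    neg-cauchy : ∀ {x} → IsCauchy x → IsCauchy (ℚ.-_ ∘ x)
    neg-cauchy {x} cx ε 0<ε with N , h ← cx ε 0<ε =
      N , λ m n N≤m N≤n → subst (ℚ._≤ ε) (eq (x m) (x n)) (h m n N≤m N≤n)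
      where
      open +-*-Solver
      eq : ∀ p q → ℚ.∣ p ℚ.- q ∣ ≡ ℚ.∣ ℚ.- p ℚ.- (ℚ.- q) ∣
      eq p q = trans (sym (ℚ.∣-p∣≡∣p∣ (p ℚ.- q)))
        (cong ℚ.∣_∣ (solve 2 (λ a b → :- (a :- b) := :- a :- (:- b)) refl p q))

    +-cauchy : ∀ {x y} → IsCauchy x → IsCauchy y → IsCauchy (λ n → x n ℚ.+ y n)
    +-cauchy {x} {y} cx cy ε 0<ε
      with M , hx ← cx (ε ℚ.* ½) (0<ε*½ 0<ε)
         | N , hy ← cy (ε ℚ.* ½) (0<ε*½ 0<ε) =
      M ℕ.⊔ N , λ m n M⊔N≤m M⊔N≤n → begin
        ℚ.∣ (x m ℚ.+ y m) ℚ.- (x n ℚ.+ y n) ∣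
          ≡⟨ cong ℚ.∣_∣ (eq (x m) (y m) (x n) (y n)) ⟩
        ℚ.∣ (x m ℚ.- x n) ℚ.+ (y m ℚ.- y n) ∣
          ≤⟨ ℚ.∣p+q∣≤∣p∣+∣q∣ (x m ℚ.- x n) (y m ℚ.- y n) ⟩
        ℚ.∣ x m ℚ.- x n ∣ ℚ.+ ℚ.∣ y m ℚ.- y n ∣
          ≤⟨ ℚ.+-mono-≤
               (hx m n (ℕ.m⊔n≤o⇒m≤o M N M⊔N≤m) (ℕ.m⊔n≤o⇒m≤o M N M⊔N≤n))
               (hy m n (ℕ.m⊔n≤o⇒n≤o M N M⊔N≤m) (ℕ.m⊔n≤o⇒n≤o M N M⊔N≤n)) ⟩
        ε ℚ.* ½ ℚ.+ ε ℚ.* ½ ≡⟨ halves ε ⟩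
        ε ∎
      where
      open ℚ.≤-Reasoning
      open +-*-Solver
      eq : ∀ a b c d → (a ℚ.+ b) ℚ.- (c ℚ.+ d) ≡ (a ℚ.- c) ℚ.+ (b ℚ.- d)
      eq = solve 4 (λ a b c d → (a :+ b) :- (c :+ d) := (a :- c) :+ (b :- d)) refl

    eventual-bound : ∀ {x} → IsCauchy x →
      ∃[ K ] 0ℚ ℚ.< K × ∃[ N ] ∀ n → N ℕ.≤ n → ℚ.∣ x n ∣ ℚ.≤ K
    eventual-bound {x} cx with N , h ← cx 1ℚ (ℚ.positive⁻¹ 1ℚ) =
      1ℚ ℚ.+ ℚ.∣ x N ∣ ,
      ℚ.+-mono-<-≤ (ℚ.positive⁻¹ 1ℚ) (ℚ.0≤∣p∣ (x N)) ,
      N , λ n N≤n → begin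
        ℚ.∣ x n ∣                         ≡⟨ cong ℚ.∣_∣ (eq (x n) (x N)) ⟩
        ℚ.∣ (x n ℚ.- x N) ℚ.+ x N ∣       ≤⟨ ℚ.∣p+q∣≤∣p∣+∣q∣ (x n ℚ.- x N) (x N) ⟩
        ℚ.∣ x n ℚ.- x N ∣ ℚ.+ ℚ.∣ x N ∣   ≤⟨ ℚ.+-monoˡ-≤ ℚ.∣ x N ∣ (h n N N≤n ℕ.≤-refl) ⟩
        1ℚ ℚ.+ ℚ.∣ x N ∣                  ∎
      where
      open ℚ.≤-Reasoning
      open +-*-Solver
      eq : ∀ a b → a ≡ (a ℚ.- b) ℚ.+ b
      eq = solve 2 (λ a b → a := (a :- b) :+ b) refl

    *-mono-≤-abs : ∀ p q {K L} → ℚ.∣ p ∣ ℚ.≤ K → ℚ.∣ q ∣ ℚ.≤ L → 0ℚ ℚ.≤ K →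
      ℚ.∣ p ℚ.* q ∣ ℚ.≤ K ℚ.* L
    *-mono-≤-abs p q {K} {L} p≤K q≤L 0≤K = begin
      ℚ.∣ p ℚ.* q ∣           ≡⟨ ℚ.∣p*q∣≡∣p∣*∣q∣ p q ⟩
      ℚ.∣ p ∣ ℚ.* ℚ.∣ q ∣     ≤⟨ ℚ.*-monoʳ-≤-nonNeg ℚ.∣ q ∣ {{ℚ.nonNegative (ℚ.0≤∣p∣ q)}} p≤K ⟩
      K ℚ.* ℚ.∣ q ∣           ≤⟨ ℚ.*-monoˡ-≤-nonNeg K {{ℚ.nonNegative 0≤K}} q≤L ⟩
      K ℚ.* L                 ∎
      where open ℚ.≤-Reasoning

    divide : ∀ {B ε} → 0ℚ ℚ.< B → 0ℚ ℚ.< ε → ∃[ δ ] 0ℚ ℚ.< δ × B ℚ.* δ ≡ ε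
    divide {B} {ε} 0<B 0<ε =
      inv ℚ.* ε ,
      ℚ.positive⁻¹ (inv ℚ.* ε) {{ℚ.pos*pos⇒pos inv {{inv-pos}} ε {{ℚ.positive 0<ε}}}} ,
      trans (sym (ℚ.*-assoc B inv ε))
        (trans (cong (ℚ._* ε) (ℚ.*-inverseʳ B {{B≢0}})) (ℚ.*-identityˡ ε))
      where
      B≢0 : ℚ.NonZero B
      B≢0 = ℚ.pos⇒nonZero B {{ℚ.positive 0<B}}
      inv : ℚ
      inv = ℚ.1/_ B {{B≢0}}
      inv-pos : ℚ.Positive inv
      inv-pos = ℚ.1/pos⇒pos B {{ℚ.positive 0<B}}

    *-split : ∀ a b c d → a ℚ.* b ℚ.- c ℚ.* d ≡ a ℚ.* (b ℚ.- d) ℚ.+ d ℚ.* (a ℚ.- c)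
    *-split = solve 4 (λ a b c d → a :* b :- c :* d := a :* (b :- d) :+ d :* (a :- c)) refl
      where open +-*-Solver

    *-estimate : ∀ a b c d {K L δ γ ε} → 0ℚ ℚ.≤ K → 0ℚ ℚ.≤ L →
      ℚ.∣ a ∣ ℚ.≤ K → ℚ.∣ d ∣ ℚ.≤ L → ℚ.∣ b ℚ.- d ∣ ℚ.≤ δ → ℚ.∣ a ℚ.- c ∣ ℚ.≤ γ →
      K ℚ.* δ ≡ ε ℚ.* ½ → L ℚ.* γ ≡ ε ℚ.* ½ → ℚ.∣ a ℚ.* b ℚ.- c ℚ.* d ∣ ℚ.≤ ε
    *-estimate a b c d {K} {L} {δ} {γ} {ε} 0≤K 0≤L a≤K d≤L b-d≤δ a-c≤γ Kδ≡ Lγ≡ = begin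
      ℚ.∣ a ℚ.* b ℚ.- c ℚ.* d ∣
        ≡⟨ cong ℚ.∣_∣ (*-split a b c d) ⟩
      ℚ.∣ a ℚ.* (b ℚ.- d) ℚ.+ d ℚ.* (a ℚ.- c) ∣
        ≤⟨ ℚ.∣p+q∣≤∣p∣+∣q∣ (a ℚ.* (b ℚ.- d)) (d ℚ.* (a ℚ.- c)) ⟩
      ℚ.∣ a ℚ.* (b ℚ.- d) ∣ ℚ.+ ℚ.∣ d ℚ.* (a ℚ.- c) ∣
        ≤⟨ ℚ.+-mono-≤ (*-mono-≤-abs a (b ℚ.- d) a≤K b-d≤δ 0≤K)
                      (*-mono-≤-abs d (a ℚ.- c) d≤L a-c≤γ 0≤L) ⟩
      K ℚ.* δ ℚ.+ L ℚ.* γ   ≡⟨ cong₂ ℚ._+_ Kδ≡ Lγ≡ ⟩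
      ε ℚ.* ½ ℚ.+ ε ℚ.* ½   ≡⟨ halves ε ⟩
      ε ∎
      where open ℚ.≤-Reasoning

    *-cauchy : ∀ {x y} → IsCauchy x → IsCauchy y → IsCauchy (λ n → x n ℚ.* y n)
    *-cauchy {x} {y} cx cy ε 0<ε =
      let K , 0<K , M₁ , hK = eventual-bound cx
          L , 0<L , M₂ , hL = eventual-bound cy
          δ , 0<δ , Kδ≡ = divide 0<K (0<ε*½ 0<ε)
          γ , 0<γ , Lγ≡ = divide 0<L (0<ε*½ 0<ε)
          N₁ , hx = cx γ 0<γ
          N₂ , hy = cy δ 0<δ
          M = M₁ ℕ.⊔ M₂
          N = N₁ ℕ.⊔ N₂
      in M ℕ.⊔ N , λ m n ≤m ≤n →
      let M≤m = ℕ.m⊔n≤o⇒m≤o M N ≤m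
          N≤m = ℕ.m⊔n≤o⇒n≤o M N ≤m
          M≤n = ℕ.m⊔n≤o⇒m≤o M N ≤n
          N≤n = ℕ.m⊔n≤o⇒n≤o M N ≤n
      in *-estimate (x m) (y m) (x n) (y n) {K} {L} {δ} {γ} {ε} (ℚ.<⇒≤ 0<K) (ℚ.<⇒≤ 0<L)
           (hK m (ℕ.m⊔n≤o⇒m≤o M₁ M₂ M≤m))
           (hL n (ℕ.m⊔n≤o⇒n≤o M₁ M₂ M≤n))
           (hy m n (ℕ.m⊔n≤o⇒n≤o N₁ N₂ N≤m) (ℕ.m⊔n≤o⇒n≤o N₁ N₂ N≤n))
           (hx m n (ℕ.m⊔n≤o⇒m≤o N₁ N₂ N≤m) (ℕ.m⊔n≤o⇒m≤o N₁ N₂ N≤n))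
           Kδ≡ Lγ≡

infix  8 -_
infixl 7 _*_
infixl 6 _+_ _-_
infix  4 _≈_ _<_ _≤_ _#_

fromℚ : ℚ → ℝ
fromℚ q = mkℝ (λ _ → q) (const-cauchy q)

fromℤ : ℤ → ℝ
fromℤ z = fromℚ (z ℚ./ 1)

fromℕ : ℕ → ℝ
fromℕ n = fromℤ (+ n)

_+_ _*_ : ℝ → ℝ → ℝ
x + y = mkℝ (λ n → seq x n ℚ.+ seq y n) (+-cauchy {seq x} {seq y} (cauchy x) (cauchy y))
x * y = mkℝ (λ n → seq x n ℚ.* seq y n) (*-cauchy {seq x} {seq y} (cauchy x) (cauchy y))

-_ : ℝ → ℝ
- x = mkℝ (λ n → ℚ.- seq x n) (neg-cauchy {seq x} (cauchy x))

_-_ : ℝ → ℝ → ℝ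
x - y = x + (- y)

record _≈_ (x y : ℝ) : Set where
  constructor mk≈
  field
    close : ∀ ε → 0ℚ ℚ.< ε →
            ∃[ N ] ∀ n → N ℕ.≤ n → ℚ.∣ seq x n ℚ.- seq y n ∣ ℚ.≤ ε

record _<_ (x y : ℝ) : Set where
  constructor mk<
  field
    gap : ∃[ ε ] 0ℚ ℚ.< ε × ∃[ N ] ∀ n → N ℕ.≤ n → seq x n ℚ.+ ε ℚ.≤ seq y n

_≤_ _#_ : ℝ → ℝ → Set
x ≤ y = ¬ (y < x)
x # y = x < y ⊎ y < x

0ℝ 1ℝ : ℝ
0ℝ = fromℕ 0
1ℝ = fromℕ 1

∑ : ∀ {n} → (Fin n → ℝ) → ℝ
∑ = foldr _+_ 0ℝ

HasCard : {A : Set} → (A → Set) → ℕ → Set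
HasCard {A} P m =
  Σ (List A) λ xs → Unique xs × (∀ a → (a List.∈ xs) ⇔ P a) × length xs ≡ m

AtMost : {A : Set} → ℕ → (A → Set) → Set
AtMost m P = ∃[ k ] HasCard P k × k ℕ.≤ m

record Graph : Set₁ where
  field
    order  : ℕ
  V : Set
  V = Fin order
  field
    _~_    : Rel V 0ℓ
    _~?_   : Decidable _~_
    ~-sym  : Symmetric _~_
    ~-irr  : Irreflexive _≡_ _~_

module _ (Γ : Graph) where
  open Graph Γ

  data Walk : ℕ → V → V → Set where
    []  : ∀ {x} → Walk 0 x x
    _∷_ : ∀ {k x y z} → x ~ y → Walk k y z → Walk (suc k) x z

  Dist : V → V → ℕ → Set
  Dist x y i = Walk i x y × (∀ j → Walk j x y → i ℕ.≤ j)

  HasDiameter : ℕ → Set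
  HasDiameter D =
    (∀ x y → ∃[ i ] i ℕ.≤ D × Dist x y i) × (∃[ x ] ∃[ y ] Dist x y D)

  -- b i and c i are unconstrained for i beyond the diameter; b i ≡ 0 at it.
  record DistanceRegular : Set where
    field
      connected : ∀ x y → ∃[ i ] Walk i x y
      b c       : ℕ → ℕ
      b-count   : ∀ i x y → Dist x y i →
                  HasCard (λ z → y ~ z × Dist x z (suc i)) (b i)
      c₀        : c 0 ≡ 0
      c-count   : ∀ i x y → Dist x y (suc i) →
                  HasCard (λ z → y ~ z × Dist x z i) (c (suc i))

    valency : ℕ
    valency = b 0

    a : ℕ → ℤ
    a i = + valency ℤ.- + b i ℤ.- + c i

  IsClique : Subset order → Set
  IsClique C = ∀ {x y} → x ∈ C → y ∈ C → x ≢ y → x ~ y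

  IsMaximalClique : Subset order → Set
  IsMaximalClique C = IsClique C × (∀ C′ → IsClique C′ → C ⊆ C′ → C ≡ C′)

  adjacency : V → V → ℝ
  adjacency x y with x ~? y
  ... | yes _ = 1ℝ
  ... | no  _ = 0ℝ

  -- Apartness _#_ expresses that the eigenvector u is nonzero.
  IsEigenvalue : ℝ → Set
  IsEigenvalue θ = Σ (V → ℝ) λ u →
    (∃[ x ] u x # 0ℝ) × (∀ x → ∑ (λ y → adjacency x y * u y) ≈ θ * u x)

  IsSmallestEigenvalue : ℝ → Set
  IsSmallestEigenvalue θ = IsEigenvalue θ × (∀ η → IsEigenvalue η → θ ≤ η)

  -- ι is the reciprocal of -θ, so the last equation says ∣C∣ = 1 + k/(-θ).
  IsDelsarteClique : DistanceRegular → Subset order → Set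
  IsDelsarteClique dr C = IsClique C ×
    ∃[ θ ] IsSmallestEigenvalue θ ×
    ∃[ ι ] (- θ) * ι ≈ 1ℝ × fromℕ ∣ C ∣ ≈ 1ℝ + fromℕ (DistanceRegular.valency dr) * ι

  IsGeometric : DistanceRegular → Set₁
  IsGeometric dr = Σ (Subset order → Set) λ 𝒞 →
    (∀ C → 𝒞 C → IsDelsarteClique dr C) ×
    (∀ x y → x ~ y → ∃! _≡_ λ C → 𝒞 C × x ∈ C × y ∈ C)

-- b - 1 divides b ^ j - 1, so the integer division is exact.
gauss : (b : ℤ) .{{_ : ℤ.NonZero (b ℤ.- + 1)}} → ℕ → ℤ
gauss b j = (b ℤ.^ j ℤ.- + 1) ℤ./ (b ℤ.- + 1)

record HasClassicalParameters {Γ : Graph} (dr : DistanceRegular Γ)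
         (D : ℕ) (b : ℤ) .{{_ : ℤ.NonZero (b ℤ.- + 1)}} (α β : ℝ) : Set where
  private
    module I = DistanceRegular dr
    [_] : ℕ → ℝ
    [ j ] = fromℤ (gauss b j)
  field
    diameter : HasDiameter Γ D
    b-eq : ∀ i → i ℕ.< D →
           fromℕ (I.b i) ≈ ([ D ] - [ i ]) * (β - α * [ i ])
    c-eq : ∀ i → 1 ℕ.≤ i → i ℕ.≤ D →
           fromℕ (I.c i) ≈ [ i ] * (1ℝ + α * [ i ℕ.∸ 1 ])

-- Partial linear spaces on the point set Fin n; a line is identified
-- with its set of points.
module _ {n : ℕ} (Line : Subset n → Set) where

  IsPartialLinearSpace : Set
  IsPartialLinearSpace = ∀ {x y ℓ m} → x ≢ y → Line ℓ → Line m →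
    x ∈ ℓ → y ∈ ℓ → x ∈ m → y ∈ m → ℓ ≡ m

  Collinear : Fin n → Fin n → Set
  Collinear x y = ∃[ ℓ ] Line ℓ × x ∈ ℓ × y ∈ ℓ

  τ≤ : ℕ → Set
  τ≤ c = ∀ x ℓ → Line ℓ → x ∉ ℓ → AtMost c (λ y → y ∈ ℓ × Collinear x y)

IsPointGraph : (Γ : Graph) → (Subset (Graph.order Γ) → Set) → Set
IsPointGraph Γ Line = ∀ x y → x ~ y ⇔ (x ≢ y × Collinear Line x y)
  where open Graph Γ

module _ {Γ : Graph} (dr : DistanceRegular Γ) where
  open Graph Γ
  open DistanceRegular dr using (a; c)

  SPLSLine : ℕ → ℕ → Subset order → Set
  SPLSLine c s C = IsMaximalClique Γ C ×
    a 1 ℤ.+ + 2 ℤ.- (+ c ℤ.- + 1) ℤ.* (+ s ℤ.- + 1) ℤ.≤ + ∣ C ∣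

  record HasSPLS (c s : ℕ) : Set where
    field
      1≤c            : 1 ℕ.≤ c
      2≤s            : 2 ℕ.≤ s
      partial-linear : IsPartialLinearSpace (SPLSLine c s)
      point-graph    : IsPointGraph Γ (SPLSLine c s)
      a₁-bound       : (+ 2 ℤ.* + s ℤ.- + 1) ℤ.* (+ c ℤ.- + 1) ℤ.≤ a 1
      lines-through  : ∀ x → AtMost s (λ ℓ → SPLSLine c s ℓ × x ∈ ℓ)
      τ-bound        : τ≤ (SPLSLine c s) c

  SPLS : ℕ → Set
  SPLS s = HasSPLS (c 2) s

{-# OPTIONS --safe #-}

-- Let r = [D] and let M be the matrix with entries u (d x y), where u₀ = 1 and
-- uᵢ₊₁ = - uᵢ (1 + α[i]) / (β - α[i]).  Then A M = - r M and M² = C M with 1 ≤ C ≤ 2; the upper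
-- bound holds because a₁ ≥ (2 s - 1)(c₂ - 1) makes the terms of C decrease geometrically.
-- For a line ℓ put δ(ℓ) = 1 - (∣ℓ∣ - 1)/β.  The function ψ = Σ_{x ∈ ℓ} M x is a
-- (- r)-eigenfunction whose sum over ℓ is ∣ℓ∣ δ(ℓ), and Σ ψ² = C ∣ℓ∣ δ(ℓ), so δ(ℓ) ≥ 0.
-- If x lies on t x lines, then Σ_{ℓ ∋ x} δ(ℓ) = t x - r, hence r ≤ t x ≤ s.
-- With N the point-line incidence matrix, N Nᵀ = A + diag t, so
--   (∣ℓ∣ δ(ℓ))² ≤ Σ_m (Σ_{y ∈ m} ψ y)² = Σ_y (t y - r) ψ(y)² ≤ κ C ∣ℓ∣ δ(ℓ),  κ = max (t - r).
-- Thus ∣ℓ∣ δ(ℓ) ≤ 2 κ, and summing over the lines through a vertex where t - r = κ gives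
-- (2 s + 1) κ ≤ 2 s κ, since ∣ℓ∣ ≥ 2 s + 1.  So κ = 0 and ∣ℓ∣ = β + 1 for every line, and then
-- A + r I = N Nᵀ is positive semidefinite, so that - r is the smallest eigenvalue.
module Submission where

import Data.Bool.Properties as Bool
open import Data.Fin as Fin using (Fin)
import Data.Fin.Properties as Fin
open import Data.Fin.Subset as Subset using (Subset; ∣_∣; inside; outside)
import Data.Fin.Subset.Properties as Subset
import Data.Integer.DivMod as ℤ
import Data.Integer.Properties as ℤ
open import Data.Integer.Solver renaming (module +-*-Solver to ℤ-Solver)
open import Data.List using (List; []; _∷_; length; filter; allFin; tabulate; map; concat; deduplicate)
open import Data.List.Membership.Propositional using (_∈_; _─_)
open import Data.List.Membership.Propositional.Properties
  using (∈-allFin; ∈-length; ∈-filter⁺; ∈-filter⁻; ∈-deduplicate⁺; ∈-deduplicate⁻; ∈-concat⁺′; ∈-concat⁻′; ∈-map⁺; ∈-map⁻)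
import Data.List.Properties as List
import Data.List.Relation.Unary.All as All
open import Data.List.Relation.Unary.AllPairs using ([]; _∷_)
open import Data.List.Relation.Unary.Any using (here; there)
open import Data.List.Relation.Unary.Unique.DecPropositional.Properties using (deduplicate-!)
open import Data.List.Relation.Unary.Unique.Propositional using (Unique)
import Data.List.Relation.Unary.Unique.Propositional.Properties as Unique
open import Data.Nat as ℕ using (zero; suc; z≤n; s≤s; _∸_)
import Data.Nat.Properties as ℕ
open import Data.Product using (∃-syntax; _×_; _,_; proj₁; proj₂)
open import Data.Rational as ℚ using (ℚ; 0ℚ; 1ℚ; ½)
import Data.Rational.Properties as ℚ
open import Data.Rational.Solver using (module +-*-Solver)
import Data.Rational.Unnormalised as ℚᵘ
import Data.Rational.Unnormalised.Properties as ℚᵘ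
open import Data.Sum using (inj₁; inj₂)
open import Data.Vec as Vec using ([]; _∷_)
import Data.Vec.Properties as Vec
open import Function using (_∘_; id; Equivalence)
open import Relation.Binary using (Tri; tri<; tri≈; tri>)
open import Relation.Binary.PropositionalEquality hiding ([_])
open import Relation.Nullary using (Dec; ¬_; yes; no; contradiction; _×-dec_)
open import Relation.Unary using (Decidable)
import Defs as ℝ

-- The number δ(ℓ) is the shortfall of the line ℓ from Delsarte's bound 1 + k/r, so its vanishing is
-- the goal. The obstacle is that vertices may lie on different numbers of lines: N Nᵀ differs from
-- A by a diagonal that need not be constant, and positivity of N Nᵀ alone says little about A + r
-- I. The way out is to let the largest excess κ bound itself, by testing N Nᵀ on the projection of
-- a single line to the (- r)-eigenspace, where A is a scalar and only the excesses remain. The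
-- constant 2 in the bound for C is chosen to fit the length of the lines: it leaves exactly the
-- margin between 2 s and 2 s + 1. The identity M² = C M is obtained without orthogonality relations
-- or multiplicities: the sum of a (- r)-eigenfunction over a sphere is determined by its value at
-- the centre, which is proved by following its sums over balls. Almost everything takes place in ℚ.
-- The parameters are recovered from the integers k and c₂, and real numbers remain only in the
-- comparison of - r with an arbitrary eigenvalue, where the eigenvector is replaced by a rational
-- approximation.

module _ where

  open import Data.Integer as ℤ using (ℤ)
  open import Data.Nat using (ℕ)
  open import Defs hiding (_+_; _*_; _-_; -_; _≤_; _<_)
  open import Data.Rational using (_+_; _*_; _-_; -_; _≤_; _<_)
  open +-*-Solver

  -- Integers in ℚ and ordered-field arithmetic

  toℚ : ℤ → ℚ
  toℚ z = z ℚ./ 1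

  ℕtoℚ : ℕ → ℚ
  ℕtoℚ n = toℚ (ℤ.+ n)

  abstract
    toℚᵘ-toℚ : ∀ z → ℚ.toℚᵘ (toℚ z) ℚᵘ.≃ ℚᵘ.mkℚᵘ z 0
    toℚᵘ-toℚ z = ℚ.toℚᵘ-fromℚᵘ (ℚᵘ.mkℚᵘ z 0)

    toℚ-+ : ∀ y z → toℚ (y ℤ.+ z) ≡ toℚ y + toℚ z
    toℚ-+ y z = ℚ.toℚᵘ-injective (begin
      ℚ.toℚᵘ (toℚ (y ℤ.+ z))                 ≈⟨ toℚᵘ-toℚ (y ℤ.+ z) ⟩
      ℚᵘ.mkℚᵘ (y ℤ.+ z) 0                    ≈⟨ ℚᵘ.*≡* (cong₂ ℤ._*_ (sym (cong₂ ℤ._+_ (ℤ.*-identityʳ y) (ℤ.*-identityʳ z))) refl) ⟩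
      ℚᵘ.mkℚᵘ y 0 ℚᵘ.+ ℚᵘ.mkℚᵘ z 0           ≈⟨ ℚᵘ.+-cong (ℚᵘ.≃-sym (toℚᵘ-toℚ y)) (ℚᵘ.≃-sym (toℚᵘ-toℚ z)) ⟩
      ℚ.toℚᵘ (toℚ y) ℚᵘ.+ ℚ.toℚᵘ (toℚ z)     ≈⟨ ℚᵘ.≃-sym (ℚ.toℚᵘ-homo-+ (toℚ y) (toℚ z)) ⟩
      ℚ.toℚᵘ (toℚ y + toℚ z)                 ∎)
      where open ℚᵘ.≃-Reasoning

    toℚ-* : ∀ y z → toℚ (y ℤ.* z) ≡ toℚ y * toℚ z
    toℚ-* y z = ℚ.toℚᵘ-injective (begin
      ℚ.toℚᵘ (toℚ (y ℤ.* z))                 ≈⟨ toℚᵘ-toℚ (y ℤ.* z) ⟩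
      ℚᵘ.mkℚᵘ (y ℤ.* z) 0                    ≈⟨ ℚᵘ.≃-refl ⟩
      ℚᵘ.mkℚᵘ y 0 ℚᵘ.* ℚᵘ.mkℚᵘ z 0           ≈⟨ ℚᵘ.*-cong (ℚᵘ.≃-sym (toℚᵘ-toℚ y)) (ℚᵘ.≃-sym (toℚᵘ-toℚ z)) ⟩
      ℚ.toℚᵘ (toℚ y) ℚᵘ.* ℚ.toℚᵘ (toℚ z)     ≈⟨ ℚᵘ.≃-sym (ℚ.toℚᵘ-homo-* (toℚ y) (toℚ z)) ⟩
      ℚ.toℚᵘ (toℚ y * toℚ z)                 ∎)
      where open ℚᵘ.≃-Reasoning

    toℚ-- : ∀ z → toℚ (ℤ.- z) ≡ - toℚ z
    toℚ-- z = begin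
      toℚ (ℤ.- z)
        ≡⟨ solve 2 (λ a c → a := (a :+ c) :- c) refl (toℚ (ℤ.- z)) (toℚ z) ⟩
      toℚ (ℤ.- z) + toℚ z - toℚ z      ≡⟨ cong (_- toℚ z) (sym (toℚ-+ (ℤ.- z) z)) ⟩
      toℚ (ℤ.- z ℤ.+ z) - toℚ z        ≡⟨ cong (λ w → toℚ w - toℚ z) (ℤ.+-inverseˡ z) ⟩
      0ℚ - toℚ z                       ≡⟨ ℚ.+-identityˡ (- toℚ z) ⟩
      - toℚ z                          ∎
      where open ≡-Reasoning

    toℚ-mono-≤ : ∀ y z → y ℤ.≤ z → toℚ y ≤ toℚ z
    toℚ-mono-≤ y z y≤z = ℚ.toℚᵘ-cancel-≤
      (ℚᵘ.≤-respˡ-≃ (ℚᵘ.≃-sym (toℚᵘ-toℚ y)) (ℚᵘ.≤-respʳ-≃ (ℚᵘ.≃-sym (toℚᵘ-toℚ z))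
        (ℚᵘ.*≤* (ℤ.*-monoʳ-≤-nonNeg (ℤ.+ 1) y≤z))))

    toℚ-mono-< : ∀ y z → y ℤ.< z → toℚ y < toℚ z
    toℚ-mono-< y z y<z = ℚ.toℚᵘ-cancel-<
      (ℚᵘ.<-respˡ-≃ (ℚᵘ.≃-sym (toℚᵘ-toℚ y)) (ℚᵘ.<-respʳ-≃ (ℚᵘ.≃-sym (toℚᵘ-toℚ z))
        (ℚᵘ.*<* (ℤ.*-monoʳ-<-pos (ℤ.+ 1) y<z))))

  toℚ-cancel-< : ∀ y z → toℚ y < toℚ z → y ℤ.< z
  toℚ-cancel-< y z y<z with z ℤ.≤? y
  ... | yes z≤y = contradiction (ℚ.<-≤-trans y<z (toℚ-mono-≤ z y z≤y)) (ℚ.<-irrefl refl)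
  ... | no  z≰y = ℤ.≰⇒> z≰y

  ℕtoℚ-suc : ∀ n → ℕtoℚ (suc n) ≡ 1ℚ + ℕtoℚ n
  ℕtoℚ-suc n = toℚ-+ (ℤ.+ 1) (ℤ.+ n)

  0≤ℕtoℚ : ∀ n → 0ℚ ≤ ℕtoℚ n
  0≤ℕtoℚ n = toℚ-mono-≤ (ℤ.+ 0) (ℤ.+ n) (ℤ.+≤+ ℕ.z≤n)

  -- Inequalities are proved throughout by exhibiting the remainder `c`: its nonnegativity is
  -- assembled from known inequalities, and the ring solver checks the identity.
  ≤-from : ∀ {p q} c → 0ℚ ≤ c → q ≡ p + c → p ≤ q
  ≤-from {p} {q} c 0≤c q≡p+c =
    subst₂ _≤_ (ℚ.+-identityʳ p) (sym q≡p+c) (ℚ.+-monoʳ-≤ p 0≤c)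

  2ℚ : ℚ
  2ℚ = 1ℚ + 1ℚ

  0<1 : 0ℚ < 1ℚ
  0<1 = ℚ.positive⁻¹ 1ℚ

  0≤1 : 0ℚ ≤ 1ℚ
  0≤1 = ℚ.<⇒≤ 0<1

  0≤2 : 0ℚ ≤ 2ℚ
  0≤2 = ℚ.nonNegative⁻¹ 2ℚ

  0≤q-p : ∀ {p q} → p ≤ q → 0ℚ ≤ q - p
  0≤q-p {p} {q} p≤q = subst (_≤ q - p) (ℚ.+-inverseʳ p) (ℚ.+-monoˡ-≤ (- p) p≤q)

  0≤+ : ∀ {p q} → 0ℚ ≤ p → 0ℚ ≤ q → 0ℚ ≤ p + q
  0≤+ = ℚ.+-mono-≤

  0≤* : ∀ {p q} → 0ℚ ≤ p → 0ℚ ≤ q → 0ℚ ≤ p * q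
  0≤* {p} {q} 0≤p 0≤q = ℚ.nonNegative⁻¹ (p * q)
    {{ℚ.nonNeg*nonNeg⇒nonNeg p {{ℚ.nonNegative 0≤p}} q {{ℚ.nonNegative 0≤q}}}}

  0<* : ∀ {p q} → 0ℚ < p → 0ℚ < q → 0ℚ < p * q
  0<* {p} {q} 0<p 0<q = ℚ.positive⁻¹ (p * q)
    {{ℚ.pos*pos⇒pos p {{ℚ.positive 0<p}} q {{ℚ.positive 0<q}}}}

  *-cancel-≤ : ∀ {p q} r → 0ℚ < r → r * p ≤ r * q → p ≤ q
  *-cancel-≤ r 0<r = ℚ.*-cancelˡ-≤-pos r {{ℚ.positive 0<r}}

  *-cancel-< : ∀ {p q} r → 0ℚ ≤ r → r * p < r * q → p < q
  *-cancel-< r 0≤r = ℚ.*-cancelˡ-<-nonNeg r {{ℚ.nonNegative 0≤r}}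

  *-mono-≤ : ∀ {p q} r → 0ℚ ≤ r → p ≤ q → r * p ≤ r * q
  *-mono-≤ r 0≤r = ℚ.*-monoˡ-≤-nonNeg r {{ℚ.nonNegative 0≤r}}

  0≤p² : ∀ p → 0ℚ ≤ p * p
  0≤p² p with ℚ.≤-total 0ℚ p
  ... | inj₁ 0≤p = 0≤* 0≤p 0≤p
  ... | inj₂ p≤0 = subst (0ℚ ≤_) (solve 1 (λ x → (:- x) :* (:- x) := x :* x) refl p)
                     (0≤* (ℚ.neg-antimono-≤ p≤0) (ℚ.neg-antimono-≤ p≤0))

  abstract
    -- A total reciprocal with default value 0 on nonpositive arguments: `0≤inv` then holds
    -- everywhere, and the recursions for `u` and `κ` need no proof that a denominator is nonzero.
    inv : ℚ → ℚ
    inv q with 0ℚ ℚ.<? q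
    ... | yes 0<q = ℚ.1/_ q {{ℚ.pos⇒nonZero q {{ℚ.positive 0<q}}}}
    ... | no  _   = 0ℚ

    *-inv : ∀ {q} → 0ℚ < q → q * inv q ≡ 1ℚ
    *-inv {q} 0<q with 0ℚ ℚ.<? q
    ... | yes 0<q′ = ℚ.*-inverseʳ q {{ℚ.pos⇒nonZero q {{ℚ.positive 0<q′}}}}
    ... | no  0≮q  = contradiction 0<q 0≮q

    0≤inv : ∀ q → 0ℚ ≤ inv q
    0≤inv q with 0ℚ ℚ.<? q
    ... | yes 0<q = ℚ.<⇒≤ (ℚ.positive⁻¹ _ {{ℚ.1/pos⇒pos q {{ℚ.positive 0<q}}}})
    ... | no  _   = ℚ.≤-refl

  *-cancel-≡ : ∀ {p q} r → 0ℚ < r → r * p ≡ r * q → p ≡ q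
  *-cancel-≡ r 0<r eq = ℚ.≤-antisym (*-cancel-≤ r 0<r (ℚ.≤-reflexive eq))
                                    (*-cancel-≤ r 0<r (ℚ.≤-reflexive (sym eq)))

  0<inv : ∀ {q} → 0ℚ < q → 0ℚ < inv q
  0<inv {q} 0<q = *-cancel-< q (ℚ.<⇒≤ 0<q) (subst₂ _<_ (sym (ℚ.*-zeroʳ q)) (sym (*-inv 0<q)) 0<1)


  -- Finite sums, indicators and counting

  ∑′ : {A : Set} → List A → (A → ℚ) → ℚ
  ∑′ []       f = 0ℚ
  ∑′ (x ∷ xs) f = f x + ∑′ xs f

  syntax ∑′ xs (λ x → e) = ∑[ x ← xs ] e
  infixr 6.5 ∑′

  module _ {A : Set} where

    ∑-cong : ∀ (xs : List A) {f g} → (∀ x → x ∈ xs → f x ≡ g x) → ∑′ xs f ≡ ∑′ xs g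
    ∑-cong []       eq = refl
    ∑-cong (x ∷ xs) eq = cong₂ _+_ (eq x (here refl)) (∑-cong xs (λ y y∈ → eq y (there y∈)))

    ∑-mono : ∀ (xs : List A) {f g} → (∀ x → x ∈ xs → f x ≤ g x) → ∑′ xs f ≤ ∑′ xs g
    ∑-mono []       le = ℚ.≤-refl
    ∑-mono (x ∷ xs) le = ℚ.+-mono-≤ (le x (here refl)) (∑-mono xs (λ y y∈ → le y (there y∈)))

    ∑-zero : ∀ (xs : List A) → ∑[ x ← xs ] 0ℚ ≡ 0ℚ
    ∑-zero []       = refl
    ∑-zero (x ∷ xs) = trans (ℚ.+-identityˡ _) (∑-zero xs)

    0≤∑ : ∀ (xs : List A) {f} → (∀ x → x ∈ xs → 0ℚ ≤ f x) → 0ℚ ≤ ∑′ xs f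
    0≤∑ xs {f} le = subst (_≤ ∑′ xs f) (∑-zero xs) (∑-mono xs le)

    ∑-+ : ∀ (xs : List A) f g → ∑[ x ← xs ] (f x + g x) ≡ ∑′ xs f + ∑′ xs g
    ∑-+ []       f g = refl
    ∑-+ (x ∷ xs) f g = trans (cong ((f x + g x) +_) (∑-+ xs f g))
      (solve 4 (λ a b c d → (a :+ b) :+ (c :+ d) := (a :+ c) :+ (b :+ d)) refl
        (f x) (g x) (∑′ xs f) (∑′ xs g))

    ∑-* : ∀ (xs : List A) c f → ∑[ x ← xs ] (c * f x) ≡ c * ∑′ xs f
    ∑-* []       c f = sym (ℚ.*-zeroʳ c)
    ∑-* (x ∷ xs) c f = trans (cong (c * f x +_) (∑-* xs c f)) (sym (ℚ.*-distribˡ-+ c (f x) (∑′ xs f)))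

    ∑-*ʳ : ∀ (xs : List A) f c → ∑[ x ← xs ] (f x * c) ≡ ∑′ xs f * c
    ∑-*ʳ xs f c = trans (∑-cong xs (λ x _ → ℚ.*-comm (f x) c)) (trans (∑-* xs c f) (ℚ.*-comm c (∑′ xs f)))

    ≤∑ : ∀ (xs : List A) {f} → (∀ x → x ∈ xs → 0ℚ ≤ f x) → ∀ {y} → y ∈ xs → f y ≤ ∑′ xs f
    ≤∑ (x ∷ xs) {f} le (here refl) = subst (_≤ f x + ∑′ xs f) (ℚ.+-identityʳ (f x))
      (ℚ.+-monoʳ-≤ (f x) (0≤∑ xs (λ y y∈ → le y (there y∈))))
    ≤∑ (x ∷ xs) {f} le {y} (there y∈) = subst (_≤ f x + ∑′ xs f) (ℚ.+-identityˡ (f y))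
      (ℚ.+-mono-≤ (le x (here refl)) (≤∑ xs (λ z z∈ → le z (there z∈)) y∈))

  ∑-swap : ∀ {A B : Set} (xs : List A) (ys : List B) (f : A → B → ℚ) →
    ∑[ x ← xs ] ∑[ y ← ys ] f x y ≡ ∑[ y ← ys ] ∑[ x ← xs ] f x y
  ∑-swap []       ys f = sym (∑-zero ys)
  ∑-swap (x ∷ xs) ys f = trans (cong (∑′ ys (f x) +_) (∑-swap xs ys f))
    (sym (∑-+ ys (f x) (λ y → ∑[ x ← xs ] f x y)))

  -- Sums over a set of vertices or lines are written as sums over the whole list weighted by this
  -- indicator, so that double counting becomes `∑-swap`.
  ind : {P : Set} → Dec P → ℚ
  ind (yes _) = 1ℚ
  ind (no  _) = 0ℚ

  ind-yes : {P : Set} (P? : Dec P) → P → ind P? ≡ 1ℚ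
  ind-yes (yes _) p = refl
  ind-yes (no ¬p) p = contradiction p ¬p

  ind-no : {P : Set} (P? : Dec P) → ¬ P → ind P? ≡ 0ℚ
  ind-no (yes p) ¬p = contradiction p ¬p
  ind-no (no _)  ¬p = refl

  ind-cong : {P Q : Set} (P? : Dec P) (Q? : Dec Q) → (P → Q) → (Q → P) → ind P? ≡ ind Q?
  ind-cong P? (yes q) f g = ind-yes P? (g q)
  ind-cong P? (no ¬q) f g = ind-no P? (λ p → ¬q (f p))

  ind-idem : {P : Set} (P? : Dec P) → ind P? * ind P? ≡ ind P?
  ind-idem (yes _) = refl
  ind-idem (no  _) = refl

  0≤ind : {P : Set} (P? : Dec P) → 0ℚ ≤ ind P?
  0≤ind (yes _) = 0≤1
  0≤ind (no  _) = ℚ.≤-refl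

  module _ {A : Set} where

    ∑-filter : ∀ {P : A → Set} (P? : Decidable P) xs f →
      ∑[ x ← xs ] (ind (P? x) * f x) ≡ ∑′ (filter P? xs) f
    ∑-filter P? []       f = refl
    ∑-filter P? (x ∷ xs) f with P? x
    ... | yes _ = cong₂ _+_ (ℚ.*-identityˡ (f x)) (∑-filter P? xs f)
    ... | no  _ = trans (cong₂ _+_ (ℚ.*-zeroˡ (f x)) (∑-filter P? xs f)) (ℚ.+-identityˡ _)

    ∑-const : ∀ (xs : List A) c → ∑[ x ← xs ] c ≡ ℕtoℚ (length xs) * c
    ∑-const []       c = sym (ℚ.*-zeroˡ c)
    ∑-const (x ∷ xs) c = begin
      c + (∑[ x ← xs ] c)              ≡⟨ cong (c +_) (∑-const xs c) ⟩
      c + ℕtoℚ (length xs) * c        ≡⟨ solve 2 (λ c l → c :+ l :* c := (con 1ℚ :+ l) :* c) refl c (ℕtoℚ (length xs)) ⟩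
      (1ℚ + ℕtoℚ (length xs)) * c     ≡⟨ cong (_* c) (sym (ℕtoℚ-suc (length xs))) ⟩
      ℕtoℚ (suc (length xs)) * c      ∎
      where open ≡-Reasoning

    ∑-single : ∀ {xs : List A} f {y} → Unique xs → y ∈ xs → (∀ x → x ∈ xs → x ≢ y → f x ≡ 0ℚ) →
      ∑′ xs f ≡ f y
    ∑-single {x ∷ xs} f {y} (x∉ ∷ u) (here refl) z = trans
      (cong (f x +_) (trans (∑-cong xs (λ w w∈ → z w (there w∈) (λ { refl → All.lookup x∉ w∈ refl }))) (∑-zero xs)))
      (ℚ.+-identityʳ (f x))
    ∑-single {x ∷ xs} f {y} (x∉ ∷ u) (there y∈) z = trans
      (cong₂ _+_ (z x (here refl) (λ { refl → All.lookup x∉ y∈ refl }))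
                 (∑-single f u y∈ (λ w w∈ → z w (there w∈))))
      (ℚ.+-identityˡ (f y))

    private
      ∈-─ : ∀ {x y : A} {ys} (x∈ : x ∈ ys) → y ∈ ys → y ≢ x → y ∈ (ys ─ x∈)
      ∈-─ (here refl)  (here refl) y≢x = contradiction refl y≢x
      ∈-─ (here refl)  (there y∈)  y≢x = y∈
      ∈-─ (there x∈)   (here refl) y≢x = here refl
      ∈-─ (there x∈)   (there y∈)  y≢x = there (∈-─ x∈ y∈ y≢x)

      length-─ : ∀ {x : A} {ys} (x∈ : x ∈ ys) → length ys ≡ suc (length (ys ─ x∈))
      length-─ (here _)                = refl
      length-─ {ys = _ ∷ _} (there x∈) = cong suc (length-─ x∈)

    -- Pigeonhole: the head of `xs` deletes one occurrence of itself from `ys`, and uniqueness keeps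
    -- the remaining entries of `xs` away from the deleted one.
    unique-⊆⇒length≤ : ∀ {xs ys : List A} → Unique xs → (∀ {x} → x ∈ xs → x ∈ ys) → length xs ℕ.≤ length ys
    unique-⊆⇒length≤ {[]}     []       sub = z≤n
    unique-⊆⇒length≤ {x ∷ xs} (x∉ ∷ u) sub =
      subst (suc (length xs) ℕ.≤_) (sym (length-─ (sub (here refl))))
        (s≤s (unique-⊆⇒length≤ u (λ {y} y∈ →
          ∈-─ (sub (here refl)) (sub (there y∈)) (λ { refl → All.lookup x∉ y∈ refl }))))

    -- Converts the enumerations inside `HasCard`, whose order is arbitrary, into sums: the filtered
    -- list and `ys` contain each other and neither has repetitions.
    ∑-ind≡length : ∀ {P : A → Set} (P? : Decidable P) {xs ys} → Unique xs → Unique ys →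
      (∀ {x} → x ∈ xs → P x → x ∈ ys) → (∀ {x} → x ∈ ys → x ∈ xs × P x) →
      ∑[ x ← xs ] ind (P? x) ≡ ℕtoℚ (length ys)
    ∑-ind≡length P? {xs} {ys} uxs uys to from = begin
      (∑[ x ← xs ] ind (P? x))         ≡⟨ ∑-cong xs (λ x _ → sym (ℚ.*-identityʳ (ind (P? x)))) ⟩
      (∑[ x ← xs ] (ind (P? x) * 1ℚ))  ≡⟨ ∑-filter P? xs (λ _ → 1ℚ) ⟩
      (∑[ x ← filter P? xs ] 1ℚ)       ≡⟨ ∑-const (filter P? xs) 1ℚ ⟩
      ℕtoℚ (length (filter P? xs)) * 1ℚ ≡⟨ ℚ.*-identityʳ _ ⟩
      ℕtoℚ (length (filter P? xs))     ≡⟨ cong ℕtoℚ (ℕ.≤-antisym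
          (unique-⊆⇒length≤ (Unique.filter⁺ P? uxs) (λ x∈ → let x∈xs , px = ∈-filter⁻ P? x∈ in to x∈xs px))
          (unique-⊆⇒length≤ uys (λ x∈ → let x∈xs , px = from x∈ in ∈-filter⁺ P? x∈xs px))) ⟩
      ℕtoℚ (length ys)                 ∎
      where open ≡-Reasoning


    argmax : ∀ (f : A → ℚ) {xs : List A} {y} → y ∈ xs → ∃[ m ] ∀ {x} → x ∈ xs → f x ≤ f m
    argmax f {x ∷ []}     _ = x , λ { (here refl) → ℚ.≤-refl }
    argmax f {x ∷ y ∷ xs} _ with argmax f {y ∷ xs} (here refl)
    ... | m , max with ℚ.≤-total (f x) (f m)
    ...   | inj₁ x≤m = m , λ { (here refl) → x≤m ; (there z∈) → max z∈ }
    ...   | inj₂ m≤x = x , λ { (here refl) → ℚ.≤-refl ; (there z∈) → ℚ.≤-trans (max z∈) m≤x }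

  -- Distances and the adjacency operator on radial functions

  module Distances (Γ : Graph) (dr : DistanceRegular Γ) (D : ℕ) (diam : HasDiameter Γ D) where

    open Graph Γ
    open DistanceRegular dr

    Vs : List V
    Vs = allFin order

    ∑ᵥ-single : ∀ (f : V → ℚ) y → (∀ x → x ≢ y → f x ≡ 0ℚ) → ∑′ Vs f ≡ f y
    ∑ᵥ-single f y z = ∑-single f (Unique.allFin⁺ order) (∈-allFin y) (λ x _ → z x)

    d : V → V → ℕ
    d x y = proj₁ (proj₁ diam x y)

    d≤D : ∀ x y → d x y ℕ.≤ D
    d≤D x y = proj₁ (proj₂ (proj₁ diam x y))

    d-dist : ∀ x y → Dist Γ x y (d x y)
    d-dist x y = proj₂ (proj₂ (proj₁ diam x y))

    dist⇒d≡ : ∀ {x y i} → Dist Γ x y i → d x y ≡ i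
    dist⇒d≡ {x} {y} {i} (w , m) = let w′ , m′ = d-dist x y in ℕ.≤-antisym (m′ i w) (m (d x y) w′)

    d≡⇒dist : ∀ {x y i} → d x y ≡ i → Dist Γ x y i
    d≡⇒dist {x} {y} refl = d-dist x y

    snoc : ∀ {k x y z} → Walk Γ k x y → y ~ z → Walk Γ (suc k) x z
    snoc []      e = e ∷ []
    snoc (f ∷ w) e = f ∷ snoc w e

    unsnoc : ∀ {k x z} → Walk Γ (suc k) x z → ∃[ y ] Walk Γ k x y × y ~ z
    unsnoc (e ∷ [])      = _ , [] , e
    unsnoc (e ∷ (f ∷ w)) = let y , w′ , e′ = unsnoc (f ∷ w) in y , e ∷ w′ , e′

    d-step : ∀ {x y z} → y ~ z → d x z ℕ.≤ suc (d x y)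
    d-step {x} {y} {z} e = proj₂ (d-dist x z) _ (snoc (proj₁ (d-dist x y)) e)

    d-refl : ∀ x → d x x ≡ 0
    d-refl x = dist⇒d≡ ([] , λ _ _ → z≤n)

    d≡0⇒≡ : ∀ {x y} → d x y ≡ 0 → x ≡ y
    d≡0⇒≡ {x} {y} d≡0 with d x y | d-dist x y
    ... | zero | [] , _ = refl

    ~⇒d≡1 : ∀ {x y} → x ~ y → d x y ≡ 1
    ~⇒d≡1 {x} {y} e with d x y in eq | proj₂ (d-dist x y) 1 (e ∷ [])
    ... | zero        | _       = contradiction e (~-irr (d≡0⇒≡ eq))
    ... | suc zero    | _       = refl
    ... | suc (suc _) | s≤s ()

    predecessor : ∀ {x z i} → Dist Γ x z (suc i) → ∃[ y ] Dist Γ x y i × y ~ z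
    predecessor (w , m) = let y , w′ , e = unsnoc w in
      y , (w′ , λ j v → ℕ.s≤s⁻¹ (m (suc j) (snoc v e))) , e

    at-distance : ∀ {x z} n i → Dist Γ x z (n ℕ.+ i) → ∃[ y ] Dist Γ x y i
    at-distance zero    i δ = _ , δ
    at-distance (suc n) i δ = let y , δ′ , _ = predecessor δ in at-distance n i δ′

    -- A geodesic of length `D` is cut at every level; this is what makes `b i` and `c (suc i)`
    -- positive below the diameter.
    edge-between : ∀ {i} → i ℕ.< D → ∃[ x ] ∃[ y ] ∃[ z ] Dist Γ x y i × y ~ z × Dist Γ x z (suc i)
    edge-between {i} i<D =
      let x , y , δ  = proj₂ diam
          z , δz     = at-distance (D ∸ suc i) (suc i) (subst (Dist Γ x y) (sym (ℕ.m∸n+n≡m i<D)) δ)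
          y′ , δ′ , e = predecessor δz
      in x , y′ , z , δ′ , e , δz

    private
      card>0 : ∀ {P : V → Set} {m} → HasCard P m → ∀ {x} → P x → 0 ℕ.< m
      card>0 (xs , _ , iff , refl) {x} px = ∈-length (Equivalence.from (iff x) px)

    0<b : ∀ {i} → i ℕ.< D → 0 ℕ.< b i
    0<b i<D = let x , y , z , δ , e , δ′ = edge-between i<D in card>0 (b-count _ x y δ) (e , δ′)

    0<c : ∀ {i} → i ℕ.< D → 0 ℕ.< c (suc i)
    0<c i<D = let x , y , z , δ , e , δ′ = edge-between i<D in card>0 (c-count _ x z δ′) (~-sym e , δ)

    adj : V → V → ℚ
    adj x y = ind (x ~? y)

    adj-sym : ∀ x y → adj x y ≡ adj y x
    adj-sym x y = ind-cong (x ~? y) (y ~? x) ~-sym ~-sym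

    private
      card-sum : ∀ {P Q : V → Set} (P? : Decidable P) {m} → HasCard Q m →
        (∀ {z} → P z → Q z) → (∀ {z} → Q z → P z) → ∑[ z ← Vs ] ind (P? z) ≡ ℕtoℚ m
      card-sum P? (xs , u , iff , refl) to from =
        ∑-ind≡length P? (Unique.allFin⁺ order) u
          (λ {z} _ pz → Equivalence.from (iff z) (to pz))
          (λ {z} z∈ → ∈-allFin z , from (Equivalence.to (iff z) z∈))

      up? : ∀ x y z → Dec (y ~ z × d x z ≡ suc (d x y))
      up? x y z = (y ~? z) ×-dec (d x z ℕ.≟ suc (d x y))

      -- With `suc` on the left, a vertex at distance 0 has no lower neighbours by arithmetic alone,
      -- in agreement with `c₀`.
      down? : ∀ x y z → Dec (y ~ z × suc (d x z) ≡ d x y)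
      down? x y z = (y ~? z) ×-dec (suc (d x z) ℕ.≟ d x y)

      ∑-up : ∀ x y → ∑[ z ← Vs ] ind (up? x y z) ≡ ℕtoℚ (b (d x y))
      ∑-up x y = card-sum (up? x y) (b-count (d x y) x y (d-dist x y))
        (λ (e , δ) → e , d≡⇒dist δ) (λ (e , δ) → e , dist⇒d≡ δ)

      ∑-down′ : ∀ x y i → d x y ≡ i → ∑[ z ← Vs ] ind (down? x y z) ≡ ℕtoℚ (c i)
      ∑-down′ x y zero    eq = begin
        (∑[ z ← Vs ] ind (down? x y z)) ≡⟨ ∑-cong Vs (λ z _ → ind-no (down? x y z) (λ (_ , δ) → ℕ.1+n≢0 (trans δ eq))) ⟩
        (∑[ z ← Vs ] 0ℚ)                ≡⟨ ∑-zero Vs ⟩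
        0ℚ                              ≡⟨ cong ℕtoℚ (sym c₀) ⟩
        ℕtoℚ (c 0)                      ∎
        where open ≡-Reasoning
      ∑-down′ x y (suc i) eq = card-sum (down? x y) (c-count i x y (d≡⇒dist eq))
        (λ (e , δ) → e , d≡⇒dist (ℕ.suc-injective (trans δ eq)))
        (λ (e , δ) → e , trans (cong suc (dist⇒d≡ δ)) (sym eq))

    degree : ∀ x → ∑[ z ← Vs ] adj x z ≡ ℕtoℚ (b 0)
    degree x = card-sum (x ~?_) (b-count 0 x x ([] , λ _ _ → z≤n))
      (λ e → e , d≡⇒dist (~⇒d≡1 e)) proj₁

    -- The action of the adjacency operator on functions of the distance to a fixed vertex.
    𝓐 : (ℕ → ℚ) → ℕ → ℚ
    𝓐 F i = ℕtoℚ (b 0) * F i + ℕtoℚ (b i) * (F (suc i) - F i) + ℕtoℚ (c i) * (F (i ∸ 1) - F i)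

    -- Every neighbour of `y` contributes `F i`, plus a correction if it is one step farther from or
    -- closer to `x`. Neighbours at the same distance need no correction, so the numbers `a i` do
    -- not appear.
    adj-radial : ∀ F x y → ∑[ z ← Vs ] (adj y z * F (d x z)) ≡ 𝓐 F (d x y)
    adj-radial F x y = begin
      (∑[ z ← Vs ] (adj y z * F (d x z)))
        ≡⟨ ∑-cong Vs (λ z _ → pointwise z) ⟩
      (∑[ z ← Vs ] (adj y z * F i + ind (up? x y z) * U + ind (down? x y z) * W))
        ≡⟨ trans (∑-+ Vs _ _) (cong (_+ ∑′ Vs (λ z → ind (down? x y z) * W)) (∑-+ Vs _ _)) ⟩
      ∑′ Vs (λ z → adj y z * F i) + ∑′ Vs (λ z → ind (up? x y z) * U) + ∑′ Vs (λ z → ind (down? x y z) * W)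
        ≡⟨ cong₂ _+_ (cong₂ _+_ (∑-*ʳ Vs (adj y) (F i)) (∑-*ʳ Vs (λ z → ind (up? x y z)) U))
                     (∑-*ʳ Vs (λ z → ind (down? x y z)) W) ⟩
      ∑′ Vs (adj y) * F i + ∑′ Vs (λ z → ind (up? x y z)) * U + ∑′ Vs (λ z → ind (down? x y z)) * W
        ≡⟨ cong₂ _+_ (cong₂ _+_ (cong (_* F i) (degree y)) (cong (_* U) (∑-up x y)))
                     (cong (_* W) (∑-down′ x y i refl)) ⟩
      𝓐 F i ∎
      where
      open ≡-Reasoning
      i = d x y
      U = F (suc i) - F i
      W = F (i ∸ 1) - F i

      eval : ∀ {p q r} z → adj y z ≡ p → ind (up? x y z) ≡ q → ind (down? x y z) ≡ r →
        p * F (d x z) ≡ p * F i + q * U + r * W →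
        adj y z * F (d x z) ≡ adj y z * F i + ind (up? x y z) * U + ind (down? x y z) * W
      eval z refl refl refl eq = eq

      split : ∀ z → Dec (y ~ z) → Dec (d x z ≡ suc i) → Dec (suc (d x z) ≡ i) →
        adj y z * F (d x z) ≡ adj y z * F i + ind (up? x y z) * U + ind (down? x y z) * W
      split z (no ¬e) _ _ =
        eval z (ind-no (y ~? z) ¬e) (ind-no (up? x y z) (¬e ∘ proj₁)) (ind-no (down? x y z) (¬e ∘ proj₁))
          (solve 4 (λ f g u w → con 0ℚ :* f := con 0ℚ :* g :+ con 0ℚ :* u :+ con 0ℚ :* w) refl
            (F (d x z)) (F i) U W)
      split z (yes e) (yes up) _ =
        eval z (ind-yes (y ~? z) e) (ind-yes (up? x y z) (e , up))
          (ind-no (down? x y z) (λ (_ , down) → ℕ.<-asym (ℕ.≤-reflexive down) (ℕ.≤-reflexive (sym up))))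
          (trans (cong (λ j → 1ℚ * F j) up)
            (solve 3 (λ f g w → con 1ℚ :* f := con 1ℚ :* g :+ con 1ℚ :* (f :- g) :+ con 0ℚ :* w) refl
              (F (suc i)) (F i) W))
      split z (yes e) (no ¬up) (yes down) =
        eval z (ind-yes (y ~? z) e) (ind-no (up? x y z) (¬up ∘ proj₂)) (ind-yes (down? x y z) (e , down))
          (trans (cong (λ j → 1ℚ * F (j ∸ 1)) down)
            (solve 3 (λ f g u → con 1ℚ :* f := con 1ℚ :* g :+ con 0ℚ :* u :+ con 1ℚ :* (f :- g)) refl
              (F (i ∸ 1)) (F i) U))
      split z (yes e) (no ¬up) (no ¬down) =
        eval z (ind-yes (y ~? z) e) (ind-no (up? x y z) (¬up ∘ proj₂)) (ind-no (down? x y z) (¬down ∘ proj₂))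
          (trans (cong (λ j → 1ℚ * F j) level)
            (solve 3 (λ g u w → con 1ℚ :* g := con 1ℚ :* g :+ con 0ℚ :* u :+ con 0ℚ :* w) refl
              (F i) U W))
        where
        level : d x z ≡ i
        level = ℕ.≤-antisym (ℕ.s≤s⁻¹ (ℕ.≤∧≢⇒< (d-step e) ¬up))
                            (ℕ.s≤s⁻¹ (ℕ.≤∧≢⇒< (d-step (~-sym e)) (¬down ∘ sym)))

      pointwise : ∀ z → adj y z * F (d x z) ≡ adj y z * F i + ind (up? x y z) * U + ind (down? x y z) * W
      pointwise z = split z (y ~? z) (d x z ℕ.≟ suc i) (suc (d x z) ℕ.≟ i)

    IsEigenfunction : ℚ → (V → ℚ) → Set
    IsEigenfunction θ g = ∀ x → ∑[ z ← Vs ] (adj x z * g z) ≡ θ * g x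

    radial : (V → ℚ) → V → (ℕ → ℚ) → ℚ
    radial g x F = ∑[ z ← Vs ] (F (d x z) * g z)

    -- By symmetry the adjacency operator moves from the radial function onto `g`, where it is
    -- multiplication by `θ`.
    radial-𝓐 : ∀ {θ g} → IsEigenfunction θ g → ∀ x F → radial g x (𝓐 F) ≡ θ * radial g x F
    radial-𝓐 {θ} {g} eig x F = begin
      (∑[ w ← Vs ] (𝓐 F (d x w) * g w))
        ≡⟨ ∑-cong Vs (λ w _ → trans (cong (_* g w) (sym (adj-radial F x w)))
                                    (sym (∑-*ʳ Vs (λ z → adj w z * F (d x z)) (g w)))) ⟩
      (∑[ w ← Vs ] ∑[ z ← Vs ] (adj w z * F (d x z) * g w))
        ≡⟨ ∑-swap Vs Vs (λ w z → adj w z * F (d x z) * g w) ⟩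
      (∑[ z ← Vs ] ∑[ w ← Vs ] (adj w z * F (d x z) * g w))
        ≡⟨ ∑-cong Vs (λ z _ → inner z) ⟩
      (∑[ z ← Vs ] (θ * (F (d x z) * g z)))
        ≡⟨ ∑-* Vs θ (λ z → F (d x z) * g z) ⟩
      θ * radial g x F ∎
      where
      open ≡-Reasoning
      inner : ∀ z → ∑[ w ← Vs ] (adj w z * F (d x z) * g w) ≡ θ * (F (d x z) * g z)
      inner z = begin
        (∑[ w ← Vs ] (adj w z * F (d x z) * g w))
          ≡⟨ ∑-cong Vs (λ w _ → trans (cong (λ a → a * F (d x z) * g w) (adj-sym w z))
               (solve 3 (λ a f g → a :* f :* g := f :* (a :* g)) refl (adj z w) (F (d x z)) (g w))) ⟩
        (∑[ w ← Vs ] (F (d x z) * (adj z w * g w)))   ≡⟨ ∑-* Vs (F (d x z)) (λ w → adj z w * g w) ⟩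
        F (d x z) * ∑′ Vs (λ w → adj z w * g w)       ≡⟨ cong (F (d x z) *_) (eig z) ⟩
        F (d x z) * (θ * g z)
          ≡⟨ solve 3 (λ f t g → f :* (t :* g) := t :* (f :* g)) refl (F (d x z)) θ (g z) ⟩
        θ * (F (d x z) * g z) ∎

  -- Gaussian numbers

  module GaussianNumbers (B : ℚ) ([_] : ℕ → ℚ) (2≤B : 2ℚ ≤ B) ([0] : [ 0 ] ≡ 0ℚ)
    ([suc] : ∀ j → [ suc j ] ≡ B * [ j ] + 1ℚ) where

    0≤B : 0ℚ ≤ B
    0≤B = ℚ.≤-trans 0≤2 2≤B

    0≤[] : ∀ i → 0ℚ ≤ [ i ]
    0≤[] zero    = ℚ.≤-reflexive (sym [0])
    0≤[] (suc i) = subst (0ℚ ≤_) (sym ([suc] i)) (0≤+ (0≤* 0≤B (0≤[] i)) 0≤1)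

    1≤[suc] : ∀ i → 1ℚ ≤ [ suc i ]
    1≤[suc] i = ≤-from (B * [ i ]) (0≤* 0≤B (0≤[] i)) (trans ([suc] i) (ℚ.+-comm (B * [ i ]) 1ℚ))

    0<[suc] : ∀ i → 0ℚ < [ suc i ]
    0<[suc] i = ℚ.<-≤-trans 0<1 (1≤[suc] i)

    0<[] : ∀ {j} → 0 ℕ.< j → 0ℚ < [ j ]
    0<[] {suc j} _ = 0<[suc] j

    []-suc : ∀ i → [ i ] + 1ℚ ≤ [ suc i ]
    []-suc i = ≤-from ((B - 2ℚ) * [ i ] + [ i ]) (0≤+ (0≤* (0≤q-p 2≤B) (0≤[] i)) (0≤[] i))
      (trans ([suc] i) (solve 2 (λ B q → B :* q :+ con 1ℚ := q :+ con 1ℚ :+ ((B :- con 2ℚ) :* q :+ q)) refl B [ i ]))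

    []-mono : ∀ {i j} → i ℕ.≤′ j → [ i ] ≤ [ j ]
    []-mono (ℕ.≤′-reflexive refl) = ℚ.≤-refl
    []-mono (ℕ.≤′-step {j} i≤j)   = ℚ.≤-trans ([]-mono i≤j)
      (≤-from ([ suc j ] - [ j ]) (0≤q-p (ℚ.≤-trans (≤-from 1ℚ 0≤1 refl) ([]-suc j)))
        (solve 2 (λ p q → q := p :+ (q :- p)) refl [ j ] [ suc j ]))

  -- Classical parameters and the eigenvalue -R

  module Classical (Γ : Graph) (dr : DistanceRegular Γ) (D : ℕ) (diam : HasDiameter Γ D)
    (B α β : ℚ) ([_] : ℕ → ℚ)
    (2≤B : 2ℚ ≤ B)
    ([0] : [ 0 ] ≡ 0ℚ)
    ([suc] : ∀ j → [ suc j ] ≡ B * [ j ] + 1ℚ)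
    (b-eq : ∀ i → i ℕ.< D → ℕtoℚ (DistanceRegular.b dr i) ≡ ([ D ] - [ i ]) * (β - α * [ i ]))
    (c-eq : ∀ i → i ℕ.< D → ℕtoℚ (DistanceRegular.c dr (suc i)) ≡ [ suc i ] * (1ℚ + α * [ i ]))
    (0<D : 0 ℕ.< D)
    where

    open GaussianNumbers B [_] 2≤B [0] [suc]
    open Distances Γ dr D diam
    open Graph Γ
    open DistanceRegular dr

    R : ℚ
    R = [ D ]

    []≤R : ∀ {i} → i ℕ.≤ D → [ i ] ≤ R
    []≤R i≤D = []-mono (ℕ.≤⇒≤′ i≤D)

    0≤R-[] : ∀ {i} → i ℕ.≤ D → 0ℚ ≤ R - [ i ]
    0≤R-[] i≤D = 0≤q-p ([]≤R i≤D)

    1≤R : 1ℚ ≤ R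
    1≤R = ℚ.≤-trans (1≤[suc] 0) ([]≤R 0<D)

    0≤R : 0ℚ ≤ R
    0≤R = 0≤[] D

    0<R : 0ℚ < R
    0<R = 0<[] 0<D

    private
      0<ℕtoℚ : ∀ {n} → 0 ℕ.< n → 0ℚ < ℕtoℚ n
      0<ℕtoℚ {n} 0<n = toℚ-mono-< (ℤ.+ 0) (ℤ.+ n) (ℤ.+<+ 0<n)

    -- The sign is read off from the count `b i`, which is positive below the diameter; `0<1+α[]`
    -- does the same with `c (suc i)`.
    0<β-α[] : ∀ {i} → i ℕ.< D → 0ℚ < β - α * [ i ]
    0<β-α[] {i} i<D = *-cancel-< (R - [ i ]) (0≤R-[] (ℕ.<⇒≤ i<D))
      (subst₂ _<_ (sym (ℚ.*-zeroʳ (R - [ i ]))) (b-eq i i<D) (0<ℕtoℚ (0<b i<D)))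

    0<1+α[] : ∀ {i} → i ℕ.< D → 0ℚ < 1ℚ + α * [ i ]
    0<1+α[] {i} i<D = *-cancel-< [ suc i ] (0≤[] (suc i))
      (subst₂ _<_ (sym (ℚ.*-zeroʳ [ suc i ])) (c-eq i i<D) (0<ℕtoℚ (0<c i<D)))

    private
      -α[0] : ∀ x → x - α * [ 0 ] ≡ x
      -α[0] x = trans (cong (λ q → x - α * q) [0]) (solve 2 (λ x α → x :- α :* con 0ℚ := x) refl x α)

    valency-eq : ℕtoℚ (b 0) ≡ R * β
    valency-eq = trans (b-eq 0 0<D) (cong₂ _*_
      (trans (cong (λ q → R - q) [0]) (solve 1 (λ x → x :- con 0ℚ := x) refl R)) (-α[0] β))

    -- At the diameter `b-count` enumerates vertices at distance `suc D`, and there are none.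
    b-diameter : b D ≡ 0
    b-diameter with proj₂ diam
    ... | x , y , δ with b-count D x y δ
    ...   | []    , _ , _   , eq = sym eq
    ...   | z ∷ _ , _ , iff , _  = contradiction
      (subst (ℕ._≤ D) (dist⇒d≡ (proj₂ (Equivalence.to (iff z) (here refl)))) (d≤D x z)) ℕ.1+n≰n

    b-eq′ : ∀ i → i ℕ.≤ D → ℕtoℚ (b i) ≡ (R - [ i ]) * (β - α * [ i ])
    b-eq′ i i≤D with ℕ.m≤n⇒m<n∨m≡n i≤D
    ... | inj₁ i<D  = b-eq i i<D
    ... | inj₂ refl = trans (cong ℕtoℚ b-diameter)
      (solve 2 (λ r y → con 0ℚ := (r :- r) :* y) refl R (β - α * R))

    -- In a geometric graph a line with points at distance i and i + 1 from x has 1 + α [ i ]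
    -- of the former, and a (-R)-eigenfunction sums to zero on every line.
    u : ℕ → ℚ
    u zero    = 1ℚ
    u (suc i) = - (u i * (1ℚ + α * [ i ]) * inv (β - α * [ i ]))

    u-step : ∀ {i} → i ℕ.< D → (β - α * [ i ]) * u (suc i) ≡ - (u i * (1ℚ + α * [ i ]))
    u-step {i} i<D = begin
      y * (- (u i * x * inv y)) ≡⟨ solve 4 (λ y u x v → y :* (:- (u :* x :* v)) := (y :* v) :* (:- (u :* x))) refl y (u i) x (inv y) ⟩
      (y * inv y) * (- (u i * x)) ≡⟨ cong (_* (- (u i * x))) (*-inv (0<β-α[] i<D)) ⟩
      1ℚ * (- (u i * x))        ≡⟨ ℚ.*-identityˡ (- (u i * x)) ⟩
      - (u i * x)               ∎
      where
      open ≡-Reasoning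
      x = 1ℚ + α * [ i ]
      y = β - α * [ i ]

    private
      -- The case `i = D` lies outside the range of `u-step`; there `b D` and `R - [ D ]` both
      -- vanish.
      b·u : ∀ {i} → i ℕ.≤ D → ℕtoℚ (b i) * u (suc i) ≡ - ((R - [ i ]) * (u i * (1ℚ + α * [ i ])))
      b·u {i} i≤D with ℕ.m≤n⇒m<n∨m≡n i≤D
      ... | inj₁ i<D  = begin
        ℕtoℚ (b i) * u (suc i)       ≡⟨ cong (_* u (suc i)) (b-eq i i<D) ⟩
        (R - [ i ]) * y * u (suc i)  ≡⟨ ℚ.*-assoc (R - [ i ]) y (u (suc i)) ⟩
        (R - [ i ]) * (y * u (suc i)) ≡⟨ cong ((R - [ i ]) *_) (u-step i<D) ⟩
        (R - [ i ]) * (- (u i * x))  ≡⟨ solve 2 (λ s t → s :* (:- t) := :- (s :* t)) refl (R - [ i ]) (u i * x) ⟩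
        - ((R - [ i ]) * (u i * x))  ∎
        where
        open ≡-Reasoning
        x = 1ℚ + α * [ i ]
        y = β - α * [ i ]
      ... | inj₂ refl = trans (cong (λ n → ℕtoℚ n * u (suc D)) b-diameter)
        (solve 3 (λ v r t → con 0ℚ :* v := :- ((r :- r) :* t)) refl (u (suc D)) R (u D * (1ℚ + α * R)))

      -- The recursion for `u` turns both terms into multiples of `u (suc i)`, with coefficients
      -- `β - α * [ i ]` and `1ℚ + α * [ i ]`, whose sum is free of `α`.
      c·u : ∀ i → i ℕ.≤ D → ℕtoℚ (c i) * (u (i ∸ 1) - u i) ≡ - ([ i ] * ((1ℚ + β) * u i))
      c·u zero    _   = trans (cong (λ n → ℕtoℚ n * (1ℚ - 1ℚ)) c₀)
        (trans (solve 1 (λ x → con 0ℚ := :- (con 0ℚ :* x)) refl ((1ℚ + β) * 1ℚ)) (cong (λ q → - (q * ((1ℚ + β) * 1ℚ))) (sym [0])))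
      c·u (suc i) i<D = begin
        ℕtoℚ (c (suc i)) * (u i - u (suc i))   ≡⟨ cong (_* (u i - u (suc i))) (c-eq i i<D) ⟩
        q * x * (u i - v)
          ≡⟨ solve 4 (λ q x u v → q :* x :* (u :- v) := q :* (:- (:- (u :* x)) :- x :* v)) refl q x (u i) v ⟩
        q * (- (- (u i * x)) - x * v)          ≡⟨ cong (λ t → q * (- t - x * v)) (sym (u-step i<D)) ⟩
        q * (- (y * v) - x * v)
          ≡⟨ solve 4 (λ q β w v → q :* (:- ((β :- w) :* v) :- (con 1ℚ :+ w) :* v) := :- (q :* ((con 1ℚ :+ β) :* v)))
               refl q β (α * [ i ]) v ⟩
        - (q * ((1ℚ + β) * v))                 ∎
        where
        open ≡-Reasoning
        q = [ suc i ]
        x = 1ℚ + α * [ i ]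
        y = β - α * [ i ]
        v = u (suc i)

    -- The two terms with factor R - [i] add up to (R - [i])(1 + β). Together with [i](1 + β) they
    -- make R(1 + β), which is subtracted from the valency R β.
    𝓐u : ∀ i → i ℕ.≤ D → 𝓐 u i ≡ (- R) * u i
    𝓐u i i≤D = begin
      ℕtoℚ (b 0) * w + ℕtoℚ (b i) * (u (suc i) - w) + ℕtoℚ (c i) * (u (i ∸ 1) - w)
        ≡⟨ cong₂ _+_ (cong₂ _+_ (cong (_* w) valency-eq)
             (trans (solve 3 (λ b v w → b :* (v :- w) := b :* v :- b :* w) refl (ℕtoℚ (b i)) (u (suc i)) w)
               (cong₂ (λ s t → s - t * w) (b·u i≤D) (b-eq′ i i≤D))))
             (c·u i i≤D) ⟩
      R * β * w + (- ((R - [ i ]) * (w * (1ℚ + α * [ i ]))) - (R - [ i ]) * (β - α * [ i ]) * w) + - ([ i ] * ((1ℚ + β) * w))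
        ≡⟨ solve 5 (λ r β α q w → r :* β :* w :+ (:- ((r :- q) :* (w :* (con 1ℚ :+ α :* q))) :- (r :- q) :* (β :- α :* q) :* w)
                     :+ :- (q :* ((con 1ℚ :+ β) :* w)) := (:- r) :* w) refl R β α [ i ] w ⟩
      (- R) * w ∎
      where
      open ≡-Reasoning
      w = u i

    u-eigen : ∀ x → IsEigenfunction (- R) (λ y → u (d x y))
    u-eigen x y = trans (adj-radial u x y) (𝓐u (d x y) (d≤D x y))

    -- By `S≡`, summing a (-R)-eigenfunction over the sphere of radius `i` multiplies its value at
    -- the centre by `κ i`.
    κ : ℕ → ℚ
    κ zero    = 1ℚ
    κ (suc i) = - (κ i * (R - [ i ]) * inv [ suc i ])

    κ-step : ∀ i → [ suc i ] * κ (suc i) ≡ - ((R - [ i ]) * κ i)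
    κ-step i = begin
      q * (- (κ i * s * inv q)) ≡⟨ solve 4 (λ q k s v → q :* (:- (k :* s :* v)) := (q :* v) :* (:- (s :* k))) refl q (κ i) s (inv q) ⟩
      q * inv q * (- (s * κ i)) ≡⟨ cong (_* (- (s * κ i))) (*-inv (0<[suc] i)) ⟩
      1ℚ * (- (s * κ i))        ≡⟨ ℚ.*-identityˡ (- (s * κ i)) ⟩
      - (s * κ i)               ∎
      where
      open ≡-Reasoning
      q = [ suc i ]
      s = R - [ i ]

    -- The partial sums of Σᵢ kᵢ uᵢ², where κᵢ = kᵢ uᵢ.
    C : ℕ → ℚ
    C zero    = 1ℚ
    C (suc i) = C i + u (suc i) * κ (suc i)

    private
      -- The ratio of consecutive terms of `C`; the signs in the recursions for `u` and `κ` cancel.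
      ρ : ℕ → ℚ
      ρ i = (1ℚ + α * [ i ]) * inv (β - α * [ i ]) * ((R - [ i ]) * inv [ suc i ])

      0≤ρ : ∀ {i} → i ℕ.< D → 0ℚ ≤ ρ i
      0≤ρ {i} i<D = 0≤* (0≤* (ℚ.<⇒≤ (0<1+α[] i<D)) (0≤inv (β - α * [ i ])))
                        (0≤* (0≤R-[] (ℕ.<⇒≤ i<D)) (0≤inv [ suc i ]))

      uκ-suc : ∀ i → u (suc i) * κ (suc i) ≡ u i * κ i * ρ i
      uκ-suc i = solve 6 (λ u x y k s t → (:- (u :* x :* y)) :* (:- (k :* s :* t)) := u :* k :* (x :* y :* (s :* t)))
        refl (u i) (1ℚ + α * [ i ]) (inv (β - α * [ i ])) (κ i) (R - [ i ]) (inv [ suc i ])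

      0≤uκ : ∀ i → i ℕ.≤ D → 0ℚ ≤ u i * κ i
      0≤uκ zero    _   = ℚ.nonNegative⁻¹ (1ℚ * 1ℚ)
      0≤uκ (suc i) i<D = subst (0ℚ ≤_) (sym (uκ-suc i)) (0≤* (0≤uκ i (ℕ.<⇒≤ i<D)) (0≤ρ i<D))

    1≤C : ∀ i → i ℕ.≤ D → 1ℚ ≤ C i
    1≤C zero    _   = ℚ.≤-refl
    1≤C (suc i) i<D = ℚ.≤-trans (1≤C i (ℕ.<⇒≤ i<D)) (≤-from (u (suc i) * κ (suc i)) (0≤uκ (suc i) i<D) refl)

    C≤2 : (∀ i → i ℕ.< D → 2ℚ * ((R - [ i ]) * (1ℚ + α * [ i ])) ≤ [ suc i ] * (β - α * [ i ])) → C D ≤ 2ℚ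
    C≤2 small = ℚ.≤-trans (C≤2-uκ D ℕ.≤-refl)
      (≤-from (u D * κ D) (0≤uκ D ℕ.≤-refl) (solve 1 (λ t → con 2ℚ := con 2ℚ :- t :+ t) refl (u D * κ D)))
      where
      2ρ≤1 : ∀ i → i ℕ.< D → 2ℚ * ρ i ≤ 1ℚ
      2ρ≤1 i i<D = subst₂ _≤_
        (solve 5 (λ t s x v w → v :* w :* (t :* (s :* x)) := t :* (x :* v :* (s :* w))) refl
          2ℚ (R - [ i ]) (1ℚ + α * [ i ]) (inv y) (inv q))
        (trans (solve 4 (λ v w q y → v :* w :* (q :* y) := (q :* w) :* (y :* v)) refl (inv y) (inv q) q y)
          (trans (cong₂ _*_ (*-inv (0<[suc] i)) (*-inv (0<β-α[] i<D))) (ℚ.*-identityˡ 1ℚ)))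
        (*-mono-≤ (inv y * inv q) (0≤* (0≤inv y) (0≤inv q)) (small i i<D))
        where
        y = β - α * [ i ]
        q = [ suc i ]

      -- The bound has to reserve room for the last term again: as the ratio is at most 1/2, that
      -- room holds the next term twice, once for the sum and once for the new reserve.
      C≤2-uκ : ∀ i → i ℕ.≤ D → C i ≤ 2ℚ - u i * κ i
      C≤2-uκ zero    _   = ℚ.≤-refl
      C≤2-uκ (suc i) i<D = subst (λ p → C i + p ≤ 2ℚ - p) (sym (uκ-suc i))
        (≤-from ((2ℚ - t - C i) + t * (1ℚ - 2ℚ * ρ i))
          (0≤+ (0≤q-p (C≤2-uκ i (ℕ.<⇒≤ i<D))) (0≤* (0≤uκ i (ℕ.<⇒≤ i<D)) (0≤q-p (2ρ≤1 i i<D))))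
          (solve 3 (λ C t p → con 2ℚ :- t :* p := C :+ t :* p :+ ((con 2ℚ :- t :- C) :+ t :* (con 1ℚ :- con 2ℚ :* p)))
            refl (C i) t (ρ i)))
        where t = u i * κ i

    -- Sphere and ball sums of an eigenfunction

    private
      δ χ : ℕ → ℕ → ℚ
      δ i j = ind (j ℕ.≟ i)
      χ i j = ind (j ℕ.≤? i)

      δ-≡ : ∀ i → δ i i ≡ 1ℚ
      δ-≡ i = ind-yes (i ℕ.≟ i) refl

      δ-≢ : ∀ {i j} → j ≢ i → δ i j ≡ 0ℚ
      δ-≢ {i} {j} = ind-no (j ℕ.≟ i)

      χ-≤ : ∀ {i j} → j ℕ.≤ i → χ i j ≡ 1ℚ
      χ-≤ {i} {j} = ind-yes (j ℕ.≤? i)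

      χ-> : ∀ {i j} → i ℕ.< j → χ i j ≡ 0ℚ
      χ-> {i} {j} i<j = ind-no (j ℕ.≤? i) (ℕ.<⇒≱ i<j)

      χ-zero : ∀ j → χ 0 j ≡ δ 0 j
      χ-zero j = ind-cong (j ℕ.≤? 0) (j ℕ.≟ 0) ℕ.n≤0⇒n≡0 ℕ.≤-reflexive

      χ-suc : ∀ i j → χ (suc i) j ≡ χ i j + δ (suc i) j
      χ-suc i j with ℕ.<-cmp j (suc i)
      ... | tri< j<  j≢ _ = trans (χ-≤ (ℕ.<⇒≤ j<)) (sym (cong₂ _+_ (χ-≤ (ℕ.s≤s⁻¹ j<)) (δ-≢ j≢)))
      ... | tri≈ _ refl _ = trans (χ-≤ {suc i} ℕ.≤-refl) (sym (cong₂ _+_ (χ-> {i} ℕ.≤-refl) (δ-≡ (suc i))))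
      ... | tri> _ j≢ j>  = trans (χ-> j>) (sym (cong₂ _+_ (χ-> (ℕ.<-trans ℕ.≤-refl j>)) (δ-≢ j≢)))

      -- The indicator of a ball is constant except across its boundary, so only the upward step at
      -- radius `i` and the downward step at radius `suc i` need correcting. Spheres would give
      -- three terms.
      𝓐χ : ∀ i j → 𝓐 (χ i) j ≡ ℕtoℚ (b 0) * χ i j - ℕtoℚ (b i) * δ i j + ℕtoℚ (c (suc i)) * δ (suc i) j
      𝓐χ i j = by-cases (ℕ.<-cmp j i) (ℕ.<-cmp j (suc i))
        where
        k = ℕtoℚ (b 0)

        below : ∀ k p q r s → k * 1ℚ + p * (1ℚ - 1ℚ) + q * (1ℚ - 1ℚ) ≡ k * 1ℚ - r * 0ℚ + s * 0ℚ
        below = solve 5 (λ k p q r s → k :* con 1ℚ :+ p :* (con 1ℚ :- con 1ℚ) :+ q :* (con 1ℚ :- con 1ℚ)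
                                    := k :* con 1ℚ :- r :* con 0ℚ :+ s :* con 0ℚ) refl

        at : ∀ k p q s → k * 1ℚ + p * (0ℚ - 1ℚ) + q * (1ℚ - 1ℚ) ≡ k * 1ℚ - p * 1ℚ + s * 0ℚ
        at = solve 4 (λ k p q s → k :* con 1ℚ :+ p :* (con 0ℚ :- con 1ℚ) :+ q :* (con 1ℚ :- con 1ℚ)
                               := k :* con 1ℚ :- p :* con 1ℚ :+ s :* con 0ℚ) refl

        next : ∀ k p q r → k * 0ℚ + p * (0ℚ - 0ℚ) + q * (1ℚ - 0ℚ) ≡ k * 0ℚ - r * 0ℚ + q * 1ℚ
        next = solve 4 (λ k p q r → k :* con 0ℚ :+ p :* (con 0ℚ :- con 0ℚ) :+ q :* (con 1ℚ :- con 0ℚ)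
                                 := k :* con 0ℚ :- r :* con 0ℚ :+ q :* con 1ℚ) refl

        above : ∀ k p q r s → k * 0ℚ + p * (0ℚ - 0ℚ) + q * (0ℚ - 0ℚ) ≡ k * 0ℚ - r * 0ℚ + s * 0ℚ
        above = solve 5 (λ k p q r s → k :* con 0ℚ :+ p :* (con 0ℚ :- con 0ℚ) :+ q :* (con 0ℚ :- con 0ℚ)
                                    := k :* con 0ℚ :- r :* con 0ℚ :+ s :* con 0ℚ) refl

        eval : ∀ j {x x₊ x₋ y z} → χ i j ≡ x → χ i (suc j) ≡ x₊ → χ i (j ∸ 1) ≡ x₋ → δ i j ≡ y → δ (suc i) j ≡ z →
          k * x + ℕtoℚ (b j) * (x₊ - x) + ℕtoℚ (c j) * (x₋ - x) ≡ k * x - ℕtoℚ (b i) * y + ℕtoℚ (c (suc i)) * z →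
          𝓐 (χ i) j ≡ k * χ i j - ℕtoℚ (b i) * δ i j + ℕtoℚ (c (suc i)) * δ (suc i) j
        eval j refl refl refl refl refl eq = eq

        by-cases : Tri (j ℕ.< i) (j ≡ i) (j ℕ.> i) →
                   Tri (j ℕ.< suc i) (j ≡ suc i) (j ℕ.> suc i) →
                   𝓐 (χ i) j ≡ k * χ i j - ℕtoℚ (b i) * δ i j + ℕtoℚ (c (suc i)) * δ (suc i) j
        by-cases (tri< j<i j≢i _) _ =
          eval j (χ-≤ (ℕ.<⇒≤ j<i)) (χ-≤ j<i) (χ-≤ (ℕ.≤-trans (ℕ.m∸n≤m j 1) (ℕ.<⇒≤ j<i))) (δ-≢ j≢i)
            (δ-≢ {suc i} {j} (λ { refl → ℕ.<-asym j<i ℕ.≤-refl }))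
            (below k (ℕtoℚ (b j)) (ℕtoℚ (c j)) (ℕtoℚ (b i)) (ℕtoℚ (c (suc i))))
        by-cases (tri≈ _ refl _) _ =
          eval j (χ-≤ {i} ℕ.≤-refl) (χ-> {i} ℕ.≤-refl) (χ-≤ (ℕ.m∸n≤m j 1)) (δ-≡ i) (δ-≢ {suc i} {i} (ℕ.1+n≢n ∘ sym))
            (at k (ℕtoℚ (b i)) (ℕtoℚ (c i)) (ℕtoℚ (c (suc i))))
        by-cases (tri> _ _ i<j) (tri< j<1+i _ _) = contradiction (ℕ.s≤s⁻¹ j<1+i) (ℕ.<⇒≱ i<j)
        by-cases (tri> _ j≢i i<j) (tri≈ _ refl _) =
          eval j (χ-> i<j) (χ-> (ℕ.<-trans i<j ℕ.≤-refl)) (χ-≤ {i} ℕ.≤-refl) (δ-≢ j≢i) (δ-≡ (suc i))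
            (next k (ℕtoℚ (b j)) (ℕtoℚ (c j)) (ℕtoℚ (b i)))
        by-cases (tri> _ j≢i i<j) (tri> _ j≢1+i 1+i<j) =
          eval j (χ-> i<j) (χ-> (ℕ.<-trans i<j ℕ.≤-refl)) (χ-> (ℕ.∸-monoˡ-≤ 1 1+i<j)) (δ-≢ j≢i) (δ-≢ j≢1+i)
            (above k (ℕtoℚ (b j)) (ℕtoℚ (c j)) (ℕtoℚ (b i)) (ℕtoℚ (c (suc i))))

    module _ {g : V → ℚ} (eig : IsEigenfunction (- R) g) (x : V) where

      private
        Λ : (ℕ → ℚ) → ℚ
        Λ = radial g x

        Λ-cong : ∀ {F G} → (∀ j → F j ≡ G j) → Λ F ≡ Λ G
        Λ-cong eq = ∑-cong Vs (λ z _ → cong (_* g z) (eq (d x z)))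

        Λ-+ : ∀ F G → Λ (λ j → F j + G j) ≡ Λ F + Λ G
        Λ-+ F G = trans (∑-cong Vs (λ z _ → ℚ.*-distribʳ-+ (g z) (F (d x z)) (G (d x z))))
                        (∑-+ Vs (λ z → F (d x z) * g z) (λ z → G (d x z) * g z))

        Λ-* : ∀ a F → Λ (λ j → a * F j) ≡ a * Λ F
        Λ-* a F = trans (∑-cong Vs (λ z _ → ℚ.*-assoc a (F (d x z)) (g z)))
                        (∑-* Vs a (λ z → F (d x z) * g z))

        S Q U : ℕ → ℚ
        S i = Λ (δ i)
        Q i = Λ (χ i)
        U i = Λ (λ j → u j * χ i j)

        S-zero : S 0 ≡ g x
        S-zero = trans (∑ᵥ-single _ x (λ z z≢x → trans (cong (_* g z) (δ-≢ (λ eq → z≢x (sym (d≡0⇒≡ eq))))) (ℚ.*-zeroˡ (g z))))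
          (trans (cong (λ i → δ 0 i * g x) (d-refl x)) (ℚ.*-identityˡ (g x)))

        Q-suc : ∀ i → Q (suc i) ≡ Q i + S (suc i)
        Q-suc i = trans (Λ-cong (χ-suc i)) (Λ-+ (χ i) (δ (suc i)))

        U-zero : U 0 ≡ S 0
        U-zero = Λ-cong eq
          where
          eq : ∀ j → u j * χ 0 j ≡ δ 0 j
          eq zero    = refl
          eq (suc j) = ℚ.*-zeroʳ (u (suc j))

        U-suc : ∀ i → U (suc i) ≡ U i + u (suc i) * S (suc i)
        U-suc i = trans (Λ-cong eq) (trans (Λ-+ (λ j → u j * χ i j) (λ j → u (suc i) * δ (suc i) j))
                                           (cong (U i +_) (Λ-* (u (suc i)) (δ (suc i)))))
          where
          at-δ : ∀ j → u j * δ (suc i) j ≡ u (suc i) * δ (suc i) j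
          at-δ j with j ℕ.≟ suc i
          ... | yes refl = refl
          ... | no  _    = trans (ℚ.*-zeroʳ (u j)) (sym (ℚ.*-zeroʳ (u (suc i))))

          eq : ∀ j → u j * χ (suc i) j ≡ u j * χ i j + u (suc i) * δ (suc i) j
          eq j = trans (cong (u j *_) (χ-suc i j))
            (trans (ℚ.*-distribˡ-+ (u j) (χ i j) (δ (suc i) j)) (cong (u j * χ i j +_) (at-δ j)))

        recurrence : ∀ i → ℕtoℚ (b 0) * Q i - ℕtoℚ (b i) * S i + ℕtoℚ (c (suc i)) * S (suc i) ≡ (- R) * Q i
        recurrence i = trans (sym lin) (radial-𝓐 { - R} {g} eig x (χ i))
          where
          k = ℕtoℚ (b 0)
          open ≡-Reasoning
          lin : Λ (𝓐 (χ i)) ≡ k * Q i - ℕtoℚ (b i) * S i + ℕtoℚ (c (suc i)) * S (suc i)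
          lin = begin
            Λ (𝓐 (χ i))
              ≡⟨ Λ-cong (λ j → trans (𝓐χ i j) (cong (λ t → k * χ i j + t + ℕtoℚ (c (suc i)) * δ (suc i) j)
                                                 (ℚ.neg-distribˡ-* (ℕtoℚ (b i)) (δ i j)))) ⟩
            Λ (λ j → k * χ i j + (- ℕtoℚ (b i)) * δ i j + ℕtoℚ (c (suc i)) * δ (suc i) j)
              ≡⟨ trans (Λ-+ (λ j → k * χ i j + (- ℕtoℚ (b i)) * δ i j) (λ j → ℕtoℚ (c (suc i)) * δ (suc i) j))
                   (cong (_+ Λ (λ j → ℕtoℚ (c (suc i)) * δ (suc i) j)) (Λ-+ (λ j → k * χ i j) (λ j → (- ℕtoℚ (b i)) * δ i j))) ⟩
            Λ (λ j → k * χ i j) + Λ (λ j → (- ℕtoℚ (b i)) * δ i j) + Λ (λ j → ℕtoℚ (c (suc i)) * δ (suc i) j)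
              ≡⟨ cong₂ _+_ (cong₂ _+_ (Λ-* k (χ i)) (trans (Λ-* (- ℕtoℚ (b i)) (δ i)) (sym (ℚ.neg-distribˡ-* (ℕtoℚ (b i)) (S i)))))
                           (Λ-* (ℕtoℚ (c (suc i))) (δ (suc i))) ⟩
            k * Q i - ℕtoℚ (b i) * S i + ℕtoℚ (c (suc i)) * S (suc i) ∎

        -- In `recurrence` the ball sum has total coefficient - R(1 + β), and the premise trades R
        -- times the ball sum for the sphere sum. Then 1 + α[i] is a common factor of both sides and
        -- cancels.
        S-step : ∀ {i} → i ℕ.< D → R * Q i ≡ (R - [ i ]) * S i → [ suc i ] * S (suc i) ≡ - ((R - [ i ]) * S i)
        S-step {i} i<D RQ = *-cancel-≡ w (0<1+α[] i<D) (begin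
          w * (q * S (suc i))
            ≡⟨ solve 3 (λ x q s → x :* (q :* s) := q :* x :* s) refl w q (S (suc i)) ⟩
          q * w * S (suc i)
            ≡⟨ cong (_* S (suc i)) (sym (c-eq i i<D)) ⟩
          ℕtoℚ (c (suc i)) * S (suc i)
            ≡⟨ solve 3 (λ p t r → r := p :- t :+ r :- p :+ t) refl (ℕtoℚ (b 0) * Q i) (ℕtoℚ (b i) * S i) (ℕtoℚ (c (suc i)) * S (suc i)) ⟩
          ℕtoℚ (b 0) * Q i - ℕtoℚ (b i) * S i + ℕtoℚ (c (suc i)) * S (suc i) - ℕtoℚ (b 0) * Q i + ℕtoℚ (b i) * S i
            ≡⟨ cong₂ (λ s t → s - t + ℕtoℚ (b i) * S i) (recurrence i) (cong (_* Q i) valency-eq) ⟩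
          (- R) * Q i - R * β * Q i + ℕtoℚ (b i) * S i
            ≡⟨ cong (λ t → (- R) * Q i - R * β * Q i + t * S i) (b-eq i i<D) ⟩
          (- R) * Q i - R * β * Q i + (R - [ i ]) * (β - α * [ i ]) * S i
            ≡⟨ solve 6 (λ r q β α n s → (:- r) :* q :- r :* β :* q :+ (r :- n) :* (β :- α :* n) :* s
                 := (:- (con 1ℚ :+ β)) :* (r :* q) :+ (r :- n) :* (β :- α :* n) :* s) refl R (Q i) β α [ i ] (S i) ⟩
          (- (1ℚ + β)) * (R * Q i) + (R - [ i ]) * (β - α * [ i ]) * S i
            ≡⟨ cong (λ t → (- (1ℚ + β)) * t + (R - [ i ]) * (β - α * [ i ]) * S i) RQ ⟩
          (- (1ℚ + β)) * ((R - [ i ]) * S i) + (R - [ i ]) * (β - α * [ i ]) * S i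
            ≡⟨ solve 5 (λ r β α n s → (:- (con 1ℚ :+ β)) :* ((r :- n) :* s) :+ (r :- n) :* (β :- α :* n) :* s
                 := (con 1ℚ :+ α :* n) :* (:- ((r :- n) :* s))) refl R β α [ i ] (S i) ⟩
          w * (- ((R - [ i ]) * S i)) ∎)
          where
          open ≡-Reasoning
          w = 1ℚ + α * [ i ]
          q = [ suc i ]

        -- The invariant that removes the ball sums and leaves a first-order recursion for the
        -- sphere sums. At `i = D` it says that the eigenfunction sums to zero over the whole graph.
        RQ≡ : ∀ i → i ℕ.≤ D → R * Q i ≡ (R - [ i ]) * S i
        RQ≡ zero    _   = trans (cong (R *_) (Λ-cong χ-zero))
          (trans (solve 2 (λ r s → r :* s := (r :- con 0ℚ) :* s) refl R (S 0)) (cong (λ q → (R - q) * S 0) (sym [0])))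
        RQ≡ (suc i) i<D = begin
          R * Q (suc i)                          ≡⟨ cong (R *_) (Q-suc i) ⟩
          R * (Q i + S (suc i))                  ≡⟨ ℚ.*-distribˡ-+ R (Q i) (S (suc i)) ⟩
          R * Q i + R * S (suc i)                ≡⟨ cong (_+ R * S (suc i)) ih ⟩
          (R - [ i ]) * S i + R * S (suc i)
            ≡⟨ solve 2 (λ t s → t :+ s := :- (:- t) :+ s) refl ((R - [ i ]) * S i) (R * S (suc i)) ⟩
          - (- ((R - [ i ]) * S i)) + R * S (suc i)
            ≡⟨ cong (λ t → - t + R * S (suc i)) (sym (S-step i<D ih)) ⟩
          - ([ suc i ] * S (suc i)) + R * S (suc i)
            ≡⟨ solve 3 (λ q s r → :- (q :* s) :+ r :* s := (r :- q) :* s) refl [ suc i ] (S (suc i)) R ⟩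
          (R - [ suc i ]) * S (suc i) ∎
          where
          open ≡-Reasoning
          ih = RQ≡ i (ℕ.<⇒≤ i<D)

        S≡ : ∀ i → i ℕ.≤ D → S i ≡ κ i * g x
        S≡ zero    _   = trans S-zero (sym (ℚ.*-identityˡ (g x)))
        S≡ (suc i) i<D = *-cancel-≡ [ suc i ] (0<[suc] i) (begin
          [ suc i ] * S (suc i)                ≡⟨ S-step i<D (RQ≡ i (ℕ.<⇒≤ i<D)) ⟩
          - ((R - [ i ]) * S i)                ≡⟨ cong (λ s → - ((R - [ i ]) * s)) (S≡ i (ℕ.<⇒≤ i<D)) ⟩
          - ((R - [ i ]) * (κ i * g x))
            ≡⟨ solve 3 (λ r k g → :- (r :* (k :* g)) := (:- (r :* k)) :* g) refl (R - [ i ]) (κ i) (g x) ⟩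
          - ((R - [ i ]) * κ i) * g x          ≡⟨ cong (_* g x) (sym (κ-step i)) ⟩
          [ suc i ] * κ (suc i) * g x          ≡⟨ ℚ.*-assoc [ suc i ] (κ (suc i)) (g x) ⟩
          [ suc i ] * (κ (suc i) * g x)        ∎)
          where open ≡-Reasoning

        U≡ : ∀ i → i ℕ.≤ D → U i ≡ C i * g x
        U≡ zero    _   = trans U-zero (S≡ 0 z≤n)
        U≡ (suc i) i<D = begin
          U (suc i)                                         ≡⟨ U-suc i ⟩
          U i + u (suc i) * S (suc i)                       ≡⟨ cong₂ (λ s t → s + u (suc i) * t) (U≡ i (ℕ.<⇒≤ i<D)) (S≡ (suc i) i<D) ⟩
          C i * g x + u (suc i) * (κ (suc i) * g x)
            ≡⟨ solve 4 (λ c u k g → c :* g :+ u :* (k :* g) := (c :+ u :* k) :* g) refl (C i) (u (suc i)) (κ (suc i)) (g x) ⟩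
          C (suc i) * g x                                   ∎
          where open ≡-Reasoning

      -- The matrix (u (d x y)) is a multiple of the orthogonal projection onto the (-R)-eigenspace.
      projection : ∑[ z ← Vs ] (u (d x z) * g z) ≡ C D * g x
      projection = trans (∑-cong Vs (λ z _ → cong (_* g z)
          (trans (sym (ℚ.*-identityʳ (u (d x z)))) (cong (u (d x z) *_) (sym (χ-≤ (d≤D x z)))))))
        (U≡ D ℕ.≤-refl)

  -- Point-line incidence in a partial linear space

  ∑-map : ∀ {A B : Set} (h : A → B) (xs : List A) f → ∑′ (map h xs) f ≡ ∑′ xs (f ∘ h)
  ∑-map h []       f = refl
  ∑-map h (x ∷ xs) f = cong (f (h x) +_) (∑-map h xs f)

  ∑-∈≡∣∣ : ∀ {n} (p : Subset n) → ∑[ z ← allFin n ] ind (z Subset.∈? p) ≡ ℕtoℚ ∣ p ∣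
  ∑-∈≡∣∣ []      = refl
  ∑-∈≡∣∣ {suc n} (s ∷ p) = begin
    ind (Fin.zero Subset.∈? s ∷ p) + (∑[ z ← tabulate Fin.suc ] ind (z Subset.∈? s ∷ p))
      ≡⟨ cong (λ zs → ind (Fin.zero Subset.∈? s ∷ p) + (∑[ z ← zs ] ind (z Subset.∈? s ∷ p))) (sym (List.map-tabulate id Fin.suc)) ⟩
    ind (Fin.zero Subset.∈? s ∷ p) + (∑[ z ← map Fin.suc (allFin n) ] ind (z Subset.∈? s ∷ p))
      ≡⟨ cong (ind (Fin.zero Subset.∈? s ∷ p) +_) (trans (∑-map Fin.suc (allFin n) _)
           (∑-cong (allFin n) (λ z _ → ind-cong (Fin.suc z Subset.∈? s ∷ p) (z Subset.∈? p) Subset.drop-there Vec.there))) ⟩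
    ind (Fin.zero Subset.∈? s ∷ p) + (∑[ z ← allFin n ] ind (z Subset.∈? p))
      ≡⟨ cong (ind (Fin.zero Subset.∈? s ∷ p) +_) (∑-∈≡∣∣ p) ⟩
    ind (Fin.zero Subset.∈? s ∷ p) + ℕtoℚ ∣ p ∣
      ≡⟨ first s ⟩
    ℕtoℚ ∣ s ∷ p ∣ ∎
    where
    open ≡-Reasoning
    first : ∀ s → ind (Fin.zero Subset.∈? s ∷ p) + ℕtoℚ ∣ p ∣ ≡ ℕtoℚ ∣ s ∷ p ∣
    first inside  = sym (ℕtoℚ-suc ∣ p ∣)
    first outside = ℚ.+-identityˡ (ℕtoℚ ∣ p ∣)

  module LineGeometry (Γ : Graph) (Line : Subset (Graph.order Γ) → Set)
    (pls : IsPartialLinearSpace Line) (pg : IsPointGraph Γ Line)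
    (s : ℕ) (through : ∀ x → AtMost s (λ ℓ → Line ℓ × x Subset.∈ ℓ))
    where

    open Graph Γ

    private
      vs : List V
      vs = allFin order

      adj : V → V → ℚ
      adj x y = ind (x ~? y)

      linesAt : V → List (Subset order)
      linesAt x = proj₁ (proj₁ (proj₂ (through x)))

      linesAt-unique : ∀ x → Unique (linesAt x)
      linesAt-unique x = proj₁ (proj₂ (proj₁ (proj₂ (through x))))

      ∈-linesAt⁺ : ∀ {x ℓ} → Line ℓ → x Subset.∈ ℓ → ℓ ∈ linesAt x
      ∈-linesAt⁺ {x} {ℓ} l x∈ = Equivalence.from (proj₁ (proj₂ (proj₂ (proj₁ (proj₂ (through x))))) ℓ) (l , x∈)

      ∈-linesAt⁻ : ∀ {x ℓ} → ℓ ∈ linesAt x → Line ℓ × x Subset.∈ ℓ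
      ∈-linesAt⁻ {x} {ℓ} = Equivalence.to (proj₁ (proj₂ (proj₂ (proj₁ (proj₂ (through x))))) ℓ)

      _≟ₛ_ : (p q : Subset order) → Dec (p ≡ q)
      _≟ₛ_ = Vec.≡-dec Bool._≟_

      incidences : List (Subset order)
      incidences = concat (map linesAt vs)

    abstract
      -- `Line` is a bare predicate, so the list of lines is assembled from the enumerations at the
      -- vertices, with repetitions removed. It reaches nonempty lines only; `line∈lines` later
      -- excludes the empty one by length.
      lines : List (Subset order)
      lines = deduplicate _≟ₛ_ incidences

      lines-unique : Unique lines
      lines-unique = deduplicate-! _≟ₛ_ incidences

      ∈-lines⁺ : ∀ {x ℓ} → Line ℓ → x Subset.∈ ℓ → ℓ ∈ lines
      ∈-lines⁺ {x} l x∈ = ∈-deduplicate⁺ _≟ₛ_ (∈-concat⁺′ (∈-linesAt⁺ l x∈) (∈-map⁺ linesAt (∈-allFin x)))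

      ∈-lines⁻ : ∀ {ℓ} → ℓ ∈ lines → Line ℓ
      ∈-lines⁻ {ℓ} ℓ∈ with ∈-concat⁻′ (map linesAt vs) (∈-deduplicate⁻ _≟ₛ_ incidences ℓ∈)
      ... | _ , ℓ∈at , at∈ with ∈-map⁻ linesAt at∈
      ...   | x , _ , refl = proj₁ (∈-linesAt⁻ {x} ℓ∈at)

    mem : V → Subset order → ℚ
    mem x ℓ = ind (x Subset.∈? ℓ)

    t : V → ℚ
    t x = ∑[ ℓ ← lines ] mem x ℓ

    t≤s : ∀ x → t x ≤ ℕtoℚ s
    t≤s x = subst (_≤ ℕtoℚ s) (sym (∑-ind≡length (x Subset.∈?_) lines-unique (linesAt-unique x)
        (λ ℓ∈ x∈ → ∈-linesAt⁺ (∈-lines⁻ ℓ∈) x∈)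
        (λ ℓ∈ → let l , x∈ = ∈-linesAt⁻ {x} ℓ∈ in ∈-lines⁺ l x∈ , x∈)))
      (subst (λ m → ℕtoℚ m ≤ ℕtoℚ s) (sym (proj₂ (proj₂ (proj₂ (proj₁ (proj₂ (through x)))))))
        (toℚ-mono-≤ (ℤ.+ proj₁ (through x)) (ℤ.+ s) (ℤ.+≤+ (proj₂ (proj₂ (through x))))))

    -- An entry of N Nᵀ. Off the diagonal the point graph supplies a common line exactly for
    -- adjacent vertices, and partial linearity makes it the only one.
    joining : ∀ y z → ∑[ ℓ ← lines ] (mem y ℓ * mem z ℓ) ≡ ind (z Fin.≟ y) * t y + adj y z
    joining y z with z Fin.≟ y | y ~? z
    ... | yes refl | yes y~y = contradiction y~y (~-irr refl)
    ... | yes refl | no _ = trans (∑-cong lines (λ ℓ _ → ind-idem (y Subset.∈? ℓ)))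
                                  (solve 1 (λ t → t := con 1ℚ :* t :+ con 0ℚ) refl (t y))
    ... | no z≢y   | yes y~z with Equivalence.to (pg y z) y~z
    ...   | y≢z , ℓ , l , y∈ , z∈ = trans
      (∑-single (λ ℓ → mem y ℓ * mem z ℓ) lines-unique (∈-lines⁺ l y∈) other)
      (trans (cong₂ _*_ (ind-yes (y Subset.∈? ℓ) y∈) (ind-yes (z Subset.∈? ℓ) z∈))
             (solve 1 (λ t → con 1ℚ :* con 1ℚ := con 0ℚ :* t :+ con 1ℚ) refl (t y)))
      where
      other : ∀ m → m ∈ lines → m ≢ ℓ → mem y m * mem z m ≡ 0ℚ
      other m m∈ m≢ℓ with y Subset.∈? m | z Subset.∈? m
      ... | no _    | z?     = ℚ.*-zeroˡ (ind z?)
      ... | yes _   | no _   = refl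
      ... | yes y∈m | yes z∈m = contradiction (pls y≢z (∈-lines⁻ m∈) l y∈m z∈m y∈ z∈) m≢ℓ
    joining y z | no z≢y   | no y≁z = trans (∑-cong lines none) (trans (∑-zero lines)
        (solve 1 (λ t → con 0ℚ := con 0ℚ :* t :+ con 0ℚ) refl (t y)))
      where
      none : ∀ m → m ∈ lines → mem y m * mem z m ≡ 0ℚ
      none m m∈ with y Subset.∈? m | z Subset.∈? m
      ... | no _    | z?     = ℚ.*-zeroˡ (ind z?)
      ... | yes _   | no _   = refl
      ... | yes y∈m | yes z∈m = contradiction
        (Equivalence.from (pg y z) ((λ y≡z → z≢y (sym y≡z)) , m , ∈-lines⁻ m∈ , y∈m , z∈m)) y≁z

    lineSum : (V → ℚ) → Subset order → ℚ
    lineSum g ℓ = ∑[ z ← vs ] (mem z ℓ * g z)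

    -- N Nᵀ = A + diag t for the point-line incidence matrix N.
    ∑-lineSum : ∀ g y → ∑[ ℓ ← lines ] (mem y ℓ * lineSum g ℓ) ≡ t y * g y + (∑[ z ← vs ] (adj y z * g z))
    ∑-lineSum g y = begin
      (∑[ ℓ ← lines ] (mem y ℓ * lineSum g ℓ))
        ≡⟨ ∑-cong lines (λ ℓ _ → trans (sym (∑-* vs (mem y ℓ) (λ z → mem z ℓ * g z)))
             (∑-cong vs (λ z _ → sym (ℚ.*-assoc (mem y ℓ) (mem z ℓ) (g z))))) ⟩
      (∑[ ℓ ← lines ] ∑[ z ← vs ] (mem y ℓ * mem z ℓ * g z))
        ≡⟨ ∑-swap lines vs (λ ℓ z → mem y ℓ * mem z ℓ * g z) ⟩
      (∑[ z ← vs ] ∑[ ℓ ← lines ] (mem y ℓ * mem z ℓ * g z))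
        ≡⟨ ∑-cong vs (λ z _ → begin
             (∑[ ℓ ← lines ] (mem y ℓ * mem z ℓ * g z))    ≡⟨ ∑-*ʳ lines (λ ℓ → mem y ℓ * mem z ℓ) (g z) ⟩
             ∑′ lines (λ ℓ → mem y ℓ * mem z ℓ) * g z      ≡⟨ cong (_* g z) (joining y z) ⟩
             (ind (z Fin.≟ y) * t y + adj y z) * g z
               ≡⟨ solve 4 (λ i t a g → (i :* t :+ a) :* g := i :* (t :* g) :+ a :* g) refl
                    (ind (z Fin.≟ y)) (t y) (adj y z) (g z) ⟩
             ind (z Fin.≟ y) * (t y * g z) + adj y z * g z ∎) ⟩
      (∑[ z ← vs ] (ind (z Fin.≟ y) * (t y * g z) + adj y z * g z))
        ≡⟨ ∑-+ vs (λ z → ind (z Fin.≟ y) * (t y * g z)) (λ z → adj y z * g z) ⟩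
      (∑[ z ← vs ] (ind (z Fin.≟ y) * (t y * g z))) + (∑[ z ← vs ] (adj y z * g z))
        ≡⟨ cong (_+ (∑[ z ← vs ] (adj y z * g z))) (trans
             (∑-single (λ z → ind (z Fin.≟ y) * (t y * g z)) (Unique.allFin⁺ order) (∈-allFin y)
               (λ z _ z≢y → trans (cong (_* (t y * g z)) (ind-no (z Fin.≟ y) z≢y)) (ℚ.*-zeroˡ (t y * g z))))
             (trans (cong (_* (t y * g y)) (ind-yes (y Fin.≟ y) refl)) (ℚ.*-identityˡ (t y * g y)))) ⟩
      t y * g y + (∑[ z ← vs ] (adj y z * g z)) ∎
      where open ≡-Reasoning

    -- The squared norm of Nᵀ g, written as the quadratic form of N Nᵀ at g.
    ∑-lineSum² : ∀ g → ∑[ ℓ ← lines ] (lineSum g ℓ * lineSum g ℓ) ≡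
      ∑[ y ← vs ] (g y * (t y * g y + (∑[ z ← vs ] (adj y z * g z))))
    ∑-lineSum² g = begin
      (∑[ ℓ ← lines ] (lineSum g ℓ * lineSum g ℓ))
        ≡⟨ ∑-cong lines (λ ℓ _ → trans (sym (∑-*ʳ vs (λ y → mem y ℓ * g y) (lineSum g ℓ)))
             (∑-cong vs (λ y _ → solve 3 (λ m g l → m :* g :* l := g :* (m :* l)) refl (mem y ℓ) (g y) (lineSum g ℓ)))) ⟩
      (∑[ ℓ ← lines ] ∑[ y ← vs ] (g y * (mem y ℓ * lineSum g ℓ)))
        ≡⟨ ∑-swap lines vs (λ ℓ y → g y * (mem y ℓ * lineSum g ℓ)) ⟩
      (∑[ y ← vs ] ∑[ ℓ ← lines ] (g y * (mem y ℓ * lineSum g ℓ)))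
        ≡⟨ ∑-cong vs (λ y _ → trans (∑-* lines (g y) (λ ℓ → mem y ℓ * lineSum g ℓ)) (cong (g y *_) (∑-lineSum g y))) ⟩
      (∑[ y ← vs ] (g y * (t y * g y + (∑[ z ← vs ] (adj y z * g z))))) ∎
      where open ≡-Reasoning

  -- All lines attain the Delsarte bound

  module Rigidity (Γ : Graph) (dr : DistanceRegular Γ) (D : ℕ) (diam : HasDiameter Γ D)
    (B α β : ℚ) ([_] : ℕ → ℚ)
    (2≤B : 2ℚ ≤ B)
    ([0] : [ 0 ] ≡ 0ℚ)
    ([suc] : ∀ j → [ suc j ] ≡ B * [ j ] + 1ℚ)
    (b-eq : ∀ i → i ℕ.< D → ℕtoℚ (DistanceRegular.b dr i) ≡ ([ D ] - [ i ]) * (β - α * [ i ]))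
    (c-eq : ∀ i → i ℕ.< D → ℕtoℚ (DistanceRegular.c dr (suc i)) ≡ [ suc i ] * (1ℚ + α * [ i ]))
    (0<D : 0 ℕ.< D)
    (Line : Subset (Graph.order Γ) → Set)
    (pls : IsPartialLinearSpace Line) (pg : IsPointGraph Γ Line)
    (s : ℕ) (through : ∀ x → AtMost s (λ ℓ → Line ℓ × x Subset.∈ ℓ))
    (clique : ∀ ℓ → Line ℓ → IsClique Γ ℓ)
    (long : ∀ ℓ → Line ℓ → 2ℚ * ℕtoℚ s + 1ℚ ≤ ℕtoℚ ∣ ℓ ∣)
    (small : [ D ] ≤ ℕtoℚ s → ∀ i → i ℕ.< D →
             2ℚ * (([ D ] - [ i ]) * (1ℚ + α * [ i ])) ≤ [ suc i ] * (β - α * [ i ]))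
    where

    open Graph Γ
    open GaussianNumbers B [_] 2≤B [0] [suc]
    open Distances Γ dr D diam
    open Classical Γ dr D diam B α β [_] 2≤B [0] [suc] b-eq c-eq 0<D
    open LineGeometry Γ Line pls pg s through
    open ≡-Reasoning

    σ : ℚ
    σ = ℕtoℚ s

    0≤σ : 0ℚ ≤ σ
    0≤σ = 0≤ℕtoℚ s

    1≤2σ+1 : 1ℚ ≤ 2ℚ * σ + 1ℚ
    1≤2σ+1 = ≤-from (2ℚ * σ) (0≤* 0≤2 0≤σ) (ℚ.+-comm (2ℚ * σ) 1ℚ)

    0<∣ℓ∣ : ∀ {ℓ} → Line ℓ → 0ℚ < ℕtoℚ ∣ ℓ ∣
    0<∣ℓ∣ {ℓ} l = ℚ.<-≤-trans 0<1 (ℚ.≤-trans 1≤2σ+1 (long ℓ l))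

    ∑-mem : ∀ ℓ → ∑[ z ← Vs ] mem z ℓ ≡ ℕtoℚ ∣ ℓ ∣
    ∑-mem = ∑-∈≡∣∣

    line∈lines : ∀ {ℓ} → Line ℓ → ℓ ∈ lines
    line∈lines {ℓ} l with Subset.nonempty? ℓ
    ... | yes (x , x∈) = ∈-lines⁺ l x∈
    ... | no empty     = contradiction (0<∣ℓ∣ l) (ℚ.<-irrefl (trans (sym (∑-zero Vs))
      (trans (∑-cong Vs (λ z _ → sym (ind-no (z Subset.∈? ℓ) (λ z∈ → empty (z , z∈))))) (∑-mem ℓ))))

    u₁ : β * u 1 ≡ - 1ℚ
    u₁ = begin
      β * u 1
        ≡⟨ solve 3 (λ β α u → β :* u := (β :- α :* con 0ℚ) :* u) refl β α (u 1) ⟩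
      (β - α * 0ℚ) * u 1             ≡⟨ cong (λ q → (β - α * q) * u 1) (sym [0]) ⟩
      (β - α * [ 0 ]) * u 1          ≡⟨ u-step 0<D ⟩
      - (1ℚ * (1ℚ + α * [ 0 ]))      ≡⟨ cong (λ q → - (1ℚ * (1ℚ + α * q))) [0] ⟩
      - (1ℚ * (1ℚ + α * 0ℚ))         ≡⟨ solve 1 (λ α → :- (con 1ℚ :* (con 1ℚ :+ α :* con 0ℚ)) := :- con 1ℚ) refl α ⟩
      - 1ℚ                           ∎

    -- The defect 1 - (∣ ℓ ∣ - 1) / β of a line.
    δ : Subset order → ℚ
    δ ℓ = 1ℚ + (ℕtoℚ ∣ ℓ ∣ - 1ℚ) * u 1

    -- The value does not depend on the point of the line: `x` contributes 1 and all other points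
    -- lie at distance 1. The sum is split as `u 1` everywhere plus a correction at `x`.
    ∑-clique : ∀ {ℓ x} → Line ℓ → x Subset.∈ ℓ → ∑[ y ← Vs ] (mem y ℓ * u (d x y)) ≡ δ ℓ
    ∑-clique {ℓ} {x} l x∈ = begin
      (∑[ y ← Vs ] (mem y ℓ * u (d x y)))
        ≡⟨ ∑-cong Vs (λ y _ → pointwise y) ⟩
      (∑[ y ← Vs ] (mem y ℓ * u 1 + ind (y Fin.≟ x) * (1ℚ - u 1)))
        ≡⟨ trans (∑-+ Vs (λ y → mem y ℓ * u 1) (λ y → ind (y Fin.≟ x) * (1ℚ - u 1)))
             (cong₂ _+_ (trans (∑-*ʳ Vs (λ y → mem y ℓ) (u 1)) (cong (_* u 1) (∑-mem ℓ)))
               (trans (∑ᵥ-single (λ y → ind (y Fin.≟ x) * (1ℚ - u 1)) x (λ y y≢x →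
                         trans (cong (_* (1ℚ - u 1)) (ind-no (y Fin.≟ x) y≢x)) (ℚ.*-zeroˡ (1ℚ - u 1))))
                      (cong (_* (1ℚ - u 1)) (ind-yes (x Fin.≟ x) refl)))) ⟩
      ℕtoℚ ∣ ℓ ∣ * u 1 + 1ℚ * (1ℚ - u 1)
        ≡⟨ solve 2 (λ n u → n :* u :+ con 1ℚ :* (con 1ℚ :- u) := con 1ℚ :+ (n :- con 1ℚ) :* u) refl (ℕtoℚ ∣ ℓ ∣) (u 1) ⟩
      δ ℓ ∎
      where
      pointwise : ∀ y → mem y ℓ * u (d x y) ≡ mem y ℓ * u 1 + ind (y Fin.≟ x) * (1ℚ - u 1)
      pointwise y with y Fin.≟ x
      ... | yes refl = trans (cong₂ (λ m i → m * u i) (ind-yes (x Subset.∈? ℓ) x∈) (d-refl x))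
        (trans (solve 1 (λ u → con 1ℚ :* con 1ℚ := con 1ℚ :* u :+ con 1ℚ :* (con 1ℚ :- u)) refl (u 1))
               (cong (λ m → m * u 1 + 1ℚ * (1ℚ - u 1)) (sym (ind-yes (x Subset.∈? ℓ) x∈))))
      ... | no y≢x with y Subset.∈? ℓ
      ...   | yes y∈ = trans (cong (λ i → 1ℚ * u i) (~⇒d≡1 (clique ℓ l x∈ y∈ (y≢x ∘ sym))))
        (solve 1 (λ u → con 1ℚ :* u := con 1ℚ :* u :+ con 0ℚ :* (con 1ℚ :- u)) refl (u 1))
      ...   | no _   = solve 2 (λ v u → con 0ℚ :* v := con 0ℚ :* u :+ con 0ℚ :* (con 1ℚ :- u)) refl (u (d x y)) (u 1)

    ψ : Subset order → V → ℚ
    ψ ℓ y = ∑[ x ← Vs ] (mem x ℓ * u (d x y))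

    ψ-eigen : ∀ ℓ → IsEigenfunction (- R) (ψ ℓ)
    ψ-eigen ℓ y = begin
      (∑[ z ← Vs ] (adj y z * ψ ℓ z))
        ≡⟨ ∑-cong Vs (λ z _ → trans (sym (∑-* Vs (adj y z) (λ x → mem x ℓ * u (d x z))))
             (∑-cong Vs (λ x _ → solve 3 (λ a m u → a :* (m :* u) := m :* (a :* u)) refl (adj y z) (mem x ℓ) (u (d x z))))) ⟩
      (∑[ z ← Vs ] ∑[ x ← Vs ] (mem x ℓ * (adj y z * u (d x z))))
        ≡⟨ ∑-swap Vs Vs (λ z x → mem x ℓ * (adj y z * u (d x z))) ⟩
      (∑[ x ← Vs ] ∑[ z ← Vs ] (mem x ℓ * (adj y z * u (d x z))))
        ≡⟨ ∑-cong Vs (λ x _ → trans (∑-* Vs (mem x ℓ) (λ z → adj y z * u (d x z)))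
             (trans (cong (mem x ℓ *_) (u-eigen x y))
               (solve 3 (λ m r u → m :* (r :* u) := r :* (m :* u)) refl (mem x ℓ) (- R) (u (d x y))))) ⟩
      (∑[ x ← Vs ] ((- R) * (mem x ℓ * u (d x y))))
        ≡⟨ ∑-* Vs (- R) (λ x → mem x ℓ * u (d x y)) ⟩
      (- R) * ψ ℓ y ∎

    E : Subset order → ℚ
    E ℓ = lineSum (ψ ℓ) ℓ

    E≡ : ∀ {ℓ} → Line ℓ → E ℓ ≡ ℕtoℚ ∣ ℓ ∣ * δ ℓ
    E≡ {ℓ} l = begin
      (∑[ y ← Vs ] (mem y ℓ * ψ ℓ y))
        ≡⟨ ∑-cong Vs (λ y _ → trans (sym (∑-* Vs (mem y ℓ) (λ x → mem x ℓ * u (d x y))))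
             (∑-cong Vs (λ x _ → solve 3 (λ a m u → a :* (m :* u) := m :* (a :* u)) refl (mem y ℓ) (mem x ℓ) (u (d x y))))) ⟩
      (∑[ y ← Vs ] ∑[ x ← Vs ] (mem x ℓ * (mem y ℓ * u (d x y))))
        ≡⟨ ∑-swap Vs Vs (λ y x → mem x ℓ * (mem y ℓ * u (d x y))) ⟩
      (∑[ x ← Vs ] ∑[ y ← Vs ] (mem x ℓ * (mem y ℓ * u (d x y))))
        ≡⟨ ∑-cong Vs (λ x _ → trans (∑-* Vs (mem x ℓ) (λ y → mem y ℓ * u (d x y))) (on-line x)) ⟩
      (∑[ x ← Vs ] (mem x ℓ * δ ℓ))
        ≡⟨ trans (∑-*ʳ Vs (λ x → mem x ℓ) (δ ℓ)) (cong (_* δ ℓ) (∑-mem ℓ)) ⟩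
      ℕtoℚ ∣ ℓ ∣ * δ ℓ ∎
      where
      on-line : ∀ x → mem x ℓ * ∑′ Vs (λ y → mem y ℓ * u (d x y)) ≡ mem x ℓ * δ ℓ
      on-line x with x Subset.∈? ℓ
      ... | yes x∈ = cong (1ℚ *_) (∑-clique l x∈)
      ... | no  _  = trans (ℚ.*-zeroˡ (∑′ Vs (λ y → mem y ℓ * u (d x y)))) (sym (ℚ.*-zeroˡ (δ ℓ)))

    -- Only one factor `ψ ℓ` is expanded. The other is an eigenfunction, so `projection` evaluates
    -- it; this is where M² = C M enters.
    ∑ψ² : ∀ ℓ → ∑[ z ← Vs ] (ψ ℓ z * ψ ℓ z) ≡ C D * E ℓ
    ∑ψ² ℓ = begin
      (∑[ z ← Vs ] (ψ ℓ z * ψ ℓ z))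
        ≡⟨ ∑-cong Vs (λ z _ → trans (sym (∑-*ʳ Vs (λ x → mem x ℓ * u (d x z)) (ψ ℓ z)))
             (∑-cong Vs (λ x _ → ℚ.*-assoc (mem x ℓ) (u (d x z)) (ψ ℓ z)))) ⟩
      (∑[ z ← Vs ] ∑[ x ← Vs ] (mem x ℓ * (u (d x z) * ψ ℓ z)))
        ≡⟨ ∑-swap Vs Vs (λ z x → mem x ℓ * (u (d x z) * ψ ℓ z)) ⟩
      (∑[ x ← Vs ] ∑[ z ← Vs ] (mem x ℓ * (u (d x z) * ψ ℓ z)))
        ≡⟨ ∑-cong Vs (λ x _ → trans (∑-* Vs (mem x ℓ) (λ z → u (d x z) * ψ ℓ z))
             (trans (cong (mem x ℓ *_) (projection (ψ-eigen ℓ) x))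
               (solve 3 (λ m c p → m :* (c :* p) := c :* (m :* p)) refl (mem x ℓ) (C D) (ψ ℓ x)))) ⟩
      (∑[ x ← Vs ] (C D * (mem x ℓ * ψ ℓ x)))
        ≡⟨ ∑-* Vs (C D) (λ x → mem x ℓ * ψ ℓ x) ⟩
      C D * E ℓ ∎

    0<C : 0ℚ < C D
    0<C = ℚ.<-≤-trans 0<1 (1≤C D ℕ.≤-refl)

    0≤E : ∀ ℓ → 0ℚ ≤ E ℓ
    0≤E ℓ = *-cancel-≤ (C D) 0<C (subst₂ _≤_ (sym (ℚ.*-zeroʳ (C D))) (∑ψ² ℓ) (0≤∑ Vs (λ z _ → 0≤p² (ψ ℓ z))))

    0≤δ : ∀ {ℓ} → Line ℓ → 0ℚ ≤ δ ℓ
    0≤δ {ℓ} l = *-cancel-≤ (ℕtoℚ ∣ ℓ ∣) (0<∣ℓ∣ l)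
      (subst₂ _≤_ (sym (ℚ.*-zeroʳ (ℕtoℚ ∣ ℓ ∣))) (E≡ l) (0≤E ℓ))

    -- `∑-lineSum` at the constant function 1 gives the total size of the lines through `x` as `t x`
    -- plus the valency R β, and β cancels against `u 1` by `u₁`.
    ∑-δ : ∀ x → ∑[ ℓ ← lines ] (mem x ℓ * δ ℓ) ≡ t x - R
    ∑-δ x = begin
      (∑[ ℓ ← lines ] (mem x ℓ * δ ℓ))
        ≡⟨ ∑-cong lines (λ ℓ _ → trans
             (solve 3 (λ m n u → m :* (con 1ℚ :+ (n :- con 1ℚ) :* u) := m :* n :* u :+ m :* (con 1ℚ :- u)) refl (mem x ℓ) (ℕtoℚ ∣ ℓ ∣) (u 1))
             (cong (λ n → mem x ℓ * n * u 1 + mem x ℓ * (1ℚ - u 1))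
               (trans (sym (∑-mem ℓ)) (∑-cong Vs (λ z _ → sym (ℚ.*-identityʳ (mem z ℓ))))))) ⟩
      (∑[ ℓ ← lines ] (mem x ℓ * lineSum (λ _ → 1ℚ) ℓ * u 1 + mem x ℓ * (1ℚ - u 1)))
        ≡⟨ ∑-+ lines (λ ℓ → mem x ℓ * lineSum (λ _ → 1ℚ) ℓ * u 1) (λ ℓ → mem x ℓ * (1ℚ - u 1)) ⟩
      ∑′ lines (λ ℓ → mem x ℓ * lineSum (λ _ → 1ℚ) ℓ * u 1) + ∑′ lines (λ ℓ → mem x ℓ * (1ℚ - u 1))
        ≡⟨ cong₂ _+_ (trans (∑-*ʳ lines (λ ℓ → mem x ℓ * lineSum (λ _ → 1ℚ) ℓ) (u 1)) (cong (_* u 1) (trans (∑-lineSum (λ _ → 1ℚ) x)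
              (cong (t x * 1ℚ +_) (trans (∑-cong Vs (λ z _ → ℚ.*-identityʳ (adj x z))) (trans (degree x) valency-eq))))))
            (∑-*ʳ lines (mem x) (1ℚ - u 1)) ⟩
      (t x * 1ℚ + R * β) * u 1 + t x * (1ℚ - u 1)
        ≡⟨ solve 4 (λ t r β u → (t :* con 1ℚ :+ r :* β) :* u :+ t :* (con 1ℚ :- u) := t :+ r :* (β :* u)) refl (t x) R β (u 1) ⟩
      t x + R * (β * u 1)   ≡⟨ cong (λ w → t x + R * w) u₁ ⟩
      t x + R * (- 1ℚ)      ≡⟨ solve 2 (λ t r → t :+ r :* (:- con 1ℚ) := t :- r) refl (t x) R ⟩
      t x - R ∎

    R≤t : ∀ x → R ≤ t x
    R≤t x = ≤-from (t x - R)
      (subst (0ℚ ≤_) (∑-δ x) (0≤∑ lines (λ ℓ ℓ∈ → 0≤* (0≤ind (x Subset.∈? ℓ)) (0≤δ (∈-lines⁻ ℓ∈)))))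
      (solve 2 (λ t r → t := r :+ (t :- r)) refl (t x) R)

    private
      maximum : ∃[ x₀ ] ∀ {x} → x ∈ Vs → t x ≤ t x₀
      maximum = argmax t (∈-allFin (proj₁ (proj₂ diam)))

      x₀ : V
      x₀ = proj₁ maximum

      κ₀ : ℚ
      κ₀ = t x₀ - R

      0≤κ₀ : 0ℚ ≤ κ₀
      0≤κ₀ = 0≤q-p (R≤t x₀)

      -- The premise R ≤ s of `small` is available only now, through `R≤t`. There is no circularity,
      -- since `0≤δ` rests on C ≥ 1 alone.
      C≤2′ : C D ≤ 2ℚ
      C≤2′ = C≤2 (small (ℚ.≤-trans (R≤t x₀) (t≤s x₀)))

      E²≤ : ∀ {ℓ} → Line ℓ → E ℓ * E ℓ ≤ κ₀ * (C D * E ℓ)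
      E²≤ {ℓ} l = ℚ.≤-trans
        (≤∑ lines {λ m → lineSum (ψ ℓ) m * lineSum (ψ ℓ) m} (λ m _ → 0≤p² (lineSum (ψ ℓ) m)) (line∈lines l))
        (subst₂ _≤_ (sym (∑-lineSum² (ψ ℓ))) (trans (∑-* Vs κ₀ (λ y → ψ ℓ y * ψ ℓ y)) (cong (κ₀ *_) (∑ψ² ℓ)))
          (∑-mono Vs (λ y y∈ → ≤-from ((t x₀ - t y) * (ψ ℓ y * ψ ℓ y)) (0≤* (0≤q-p (proj₂ maximum y∈)) (0≤p² (ψ ℓ y)))
            (trans (solve 4 (λ t₀ t r p → (t₀ :- r) :* (p :* p) := p :* (t :* p :+ (:- r) :* p) :+ (t₀ :- t) :* (p :* p)) refl (t x₀) (t y) R (ψ ℓ y))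
              (cong (λ w → ψ ℓ y * (t y * ψ ℓ y + w) + (t x₀ - t y) * (ψ ℓ y * ψ ℓ y)) (sym (ψ-eigen ℓ y)))))))

      E≤ : ∀ {ℓ} → Line ℓ → E ℓ ≤ 2ℚ * κ₀
      E≤ {ℓ} l with 0ℚ ℚ.<? E ℓ
      ... | no  E≤0 = ℚ.≤-trans (ℚ.≮⇒≥ E≤0) (0≤* 0≤2 0≤κ₀)
      ... | yes 0<E = ℚ.≤-trans
        (*-cancel-≤ (E ℓ) 0<E (subst (E ℓ * E ℓ ≤_)
          (solve 3 (λ k c e → k :* (c :* e) := e :* (k :* c)) refl κ₀ (C D) (E ℓ)) (E²≤ l)))
        (subst (κ₀ * C D ≤_) (ℚ.*-comm κ₀ 2ℚ) (*-mono-≤ κ₀ 0≤κ₀ C≤2′))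

      δ≤ : ∀ {ℓ} → Line ℓ → (2ℚ * σ + 1ℚ) * δ ℓ ≤ 2ℚ * κ₀
      δ≤ {ℓ} l = ℚ.≤-trans
        (≤-from ((ℕtoℚ ∣ ℓ ∣ - (2ℚ * σ + 1ℚ)) * δ ℓ) (0≤* (0≤q-p (long ℓ l)) (0≤δ l))
          (trans (E≡ l) (solve 3 (λ n s e → n :* e := s :* e :+ (n :- s) :* e) refl (ℕtoℚ ∣ ℓ ∣) (2ℚ * σ + 1ℚ) (δ ℓ))))
        (E≤ l)

      κ₀≤0 : κ₀ ≤ 0ℚ
      κ₀≤0 = ≤-from (0ℚ - κ₀) (subst (0ℚ ≤_) (solve 3 (λ s t k → con 2ℚ :* s :* k :- (con 2ℚ :* s :+ con 1ℚ) :* k := con 0ℚ :- k) refl σ (t x₀) κ₀)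
          (0≤q-p (ℚ.≤-trans
            (subst₂ _≤_ lhs rhs (∑-mono lines (λ ℓ ℓ∈ → *-mono-≤ (mem x₀ ℓ) (0≤ind (x₀ Subset.∈? ℓ)) (δ≤ (∈-lines⁻ ℓ∈)))))
            (≤-from ((σ - t x₀) * (2ℚ * κ₀)) (0≤* (0≤q-p (t≤s x₀)) (0≤* 0≤2 0≤κ₀))
              (solve 3 (λ s t k → con 2ℚ :* s :* k := t :* (con 2ℚ :* k) :+ (s :- t) :* (con 2ℚ :* k)) refl σ (t x₀) κ₀)))))
        (solve 1 (λ k → con 0ℚ := k :+ (con 0ℚ :- k)) refl κ₀)
        where
        lhs : ∑[ ℓ ← lines ] (mem x₀ ℓ * ((2ℚ * σ + 1ℚ) * δ ℓ)) ≡ (2ℚ * σ + 1ℚ) * κ₀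
        lhs = trans (∑-cong lines (λ ℓ _ → solve 3 (λ m s e → m :* (s :* e) := s :* (m :* e)) refl (mem x₀ ℓ) (2ℚ * σ + 1ℚ) (δ ℓ)))
          (trans (∑-* lines (2ℚ * σ + 1ℚ) (λ ℓ → mem x₀ ℓ * δ ℓ)) (cong ((2ℚ * σ + 1ℚ) *_) (∑-δ x₀)))
        rhs : ∑[ ℓ ← lines ] (mem x₀ ℓ * (2ℚ * κ₀)) ≡ t x₀ * (2ℚ * κ₀)
        rhs = ∑-*ʳ lines (mem x₀) (2ℚ * κ₀)

    t≡R : ∀ x → t x ≡ R
    t≡R x = ℚ.≤-antisym
      (ℚ.≤-trans (proj₂ maximum (∈-allFin x))
        (subst₂ _≤_ (solve 2 (λ t r → t :- r :+ r := t) refl (t x₀) R) (ℚ.+-identityˡ R) (ℚ.+-monoˡ-≤ R κ₀≤0)))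
      (R≤t x)

    line-size : ∀ ℓ → Line ℓ → ℕtoℚ ∣ ℓ ∣ ≡ 1ℚ + β
    line-size ℓ l = begin
      n                               ≡⟨ solve 2 (λ n β → n := con 1ℚ :+ β :+ (con 0ℚ :- (β :+ (n :- con 1ℚ) :* (:- con 1ℚ)))) refl n β ⟩
      1ℚ + β + (0ℚ - (β + (n - 1ℚ) * (- 1ℚ)))   ≡⟨ cong (λ w → 1ℚ + β + (0ℚ - w)) βδ≡0 ⟩
      1ℚ + β + (0ℚ - 0ℚ)              ≡⟨ solve 1 (λ β → con 1ℚ :+ β :+ (con 0ℚ :- con 0ℚ) := con 1ℚ :+ β) refl β ⟩
      1ℚ + β                          ∎
      where
      n = ℕtoℚ ∣ ℓ ∣

      δ≡0 : δ ℓ ≡ 0ℚ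
      δ≡0 = ℚ.≤-antisym
        (*-cancel-≤ (2ℚ * σ + 1ℚ) (ℚ.<-≤-trans 0<1 1≤2σ+1) (subst ((2ℚ * σ + 1ℚ) * δ ℓ ≤_) (sym (ℚ.*-zeroʳ (2ℚ * σ + 1ℚ)))
          (ℚ.≤-trans (δ≤ l) (subst (2ℚ * κ₀ ≤_) (ℚ.*-zeroʳ 2ℚ) (*-mono-≤ 2ℚ 0≤2 κ₀≤0)))))
        (0≤δ l)

      βδ≡0 : β + (n - 1ℚ) * (- 1ℚ) ≡ 0ℚ
      βδ≡0 = begin
        β + (n - 1ℚ) * (- 1ℚ)       ≡⟨ cong (λ w → β + (n - 1ℚ) * w) (sym u₁) ⟩
        β + (n - 1ℚ) * (β * u 1)    ≡⟨ solve 3 (λ β n u → β :+ (n :- con 1ℚ) :* (β :* u) := β :* (con 1ℚ :+ (n :- con 1ℚ) :* u)) refl β n (u 1) ⟩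
        β * δ ℓ                     ≡⟨ cong (β *_) δ≡0 ⟩
        β * 0ℚ                      ≡⟨ ℚ.*-zeroʳ β ⟩
        0ℚ                          ∎

    -- Stated for rational vectors; `θ-smallest` brings real eigenvectors into this form.
    0≤adjacency+R : ∀ w → 0ℚ ≤ ∑[ y ← Vs ] (w y * (R * w y + (∑[ z ← Vs ] (adj y z * w z))))
    0≤adjacency+R w = subst (0ℚ ≤_)
      (trans (∑-lineSum² w) (∑-cong Vs (λ y _ → cong (λ r → w y * (r * w y + (∑[ z ← Vs ] (adj y z * w z)))) (t≡R y))))
      (0≤∑ lines (λ ℓ _ → 0≤p² (lineSum w ℓ)))

  -- Exactness of the division in the Gaussian numbers

  m*n/n≡m : ∀ m n .{{_ : ℤ.NonZero n}} → (m ℤ.* n) ℤ./ n ≡ m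
  m*n/n≡m m n = sym (ℤ.i-j≡0⇒i≡j m q (ℤ.∣i∣≡0⇒i≡0 (ℕ.n<1⇒n≡0 (ℕ.*-cancelʳ-< (ℤ.∣ n ∣) ℤ.∣ m ℤ.- q ∣ 1 small))))
    where
    q = (m ℤ.* n) ℤ./ n
    r = (m ℤ.* n) ℤ.% n
    eq : (m ℤ.- q) ℤ.* n ≡ ℤ.+ r
    eq = begin
      (m ℤ.- q) ℤ.* n                  ≡⟨ ℤS.solve 3 (λ m q n → (m ℤS.:- q) ℤS.:* n ℤS.:= m ℤS.:* n ℤS.:- q ℤS.:* n) refl m q n ⟩
      m ℤ.* n ℤ.- q ℤ.* n              ≡⟨ cong (λ w → w ℤ.- q ℤ.* n) (ℤ.a≡a%n+[a/n]*n (m ℤ.* n) n) ⟩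
      ℤ.+ r ℤ.+ q ℤ.* n ℤ.- q ℤ.* n      ≡⟨ ℤS.solve 2 (λ r t → r ℤS.:+ t ℤS.:- t ℤS.:= r) refl (ℤ.+ r) (q ℤ.* n) ⟩
      ℤ.+ r                              ∎
      where
      open ≡-Reasoning
      module ℤS = ℤ-Solver
    -- The multiple (m - q) n is the remainder of the division, hence smaller than |n|, and the
    -- integer m - q must vanish. The argument covers both signs of n.
    small : ℤ.∣ m ℤ.- q ∣ ℕ.* ℤ.∣ n ∣ ℕ.< 1 ℕ.* ℤ.∣ n ∣
    small = subst₂ ℕ._<_ (trans (cong ℤ.∣_∣ (sym eq)) (ℤ.abs-* (m ℤ.- q) n)) (sym (ℕ.*-identityˡ ℤ.∣ n ∣)) (ℤ.n%d<d (m ℤ.* n) n)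

  module _ (b : ℤ) .{{_ : ℤ.NonZero (b ℤ.- ℤ.+ 1)}} where

    private
      -- The sum 1 + b + ... + b^(j-1) by Horner's rule, a division-free form of [j].
      geometric : ℕ → ℤ
      geometric zero    = ℤ.+ 0
      geometric (suc j) = b ℤ.* geometric j ℤ.+ ℤ.+ 1

      geometric-* : ∀ j → b ℤ.^ j ℤ.- ℤ.+ 1 ≡ geometric j ℤ.* (b ℤ.- ℤ.+ 1)
      geometric-* zero    = refl
      geometric-* (suc j) = begin
        b ℤ.* b ℤ.^ j ℤ.- ℤ.+ 1
          ≡⟨ ℤS.solve 2 (λ b p → b ℤS.:* p ℤS.:- ℤS.con (ℤ.+ 1) ℤS.:= b ℤS.:* (p ℤS.:- ℤS.con (ℤ.+ 1)) ℤS.:+ (b ℤS.:- ℤS.con (ℤ.+ 1))) refl b (b ℤ.^ j) ⟩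
        b ℤ.* (b ℤ.^ j ℤ.- ℤ.+ 1) ℤ.+ (b ℤ.- ℤ.+ 1)
          ≡⟨ cong (λ w → b ℤ.* w ℤ.+ (b ℤ.- ℤ.+ 1)) (geometric-* j) ⟩
        b ℤ.* (geometric j ℤ.* (b ℤ.- ℤ.+ 1)) ℤ.+ (b ℤ.- ℤ.+ 1)
          ≡⟨ ℤS.solve 2 (λ b g → b ℤS.:* (g ℤS.:* (b ℤS.:- ℤS.con (ℤ.+ 1))) ℤS.:+ (b ℤS.:- ℤS.con (ℤ.+ 1))
               ℤS.:= (b ℤS.:* g ℤS.:+ ℤS.con (ℤ.+ 1)) ℤS.:* (b ℤS.:- ℤS.con (ℤ.+ 1))) refl b (geometric j) ⟩
        geometric (suc j) ℤ.* (b ℤ.- ℤ.+ 1) ∎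
        where
        open ≡-Reasoning
        module ℤS = ℤ-Solver

      gauss≡geometric : ∀ j → gauss b j ≡ geometric j
      gauss≡geometric j = trans (cong (ℤ._/ (b ℤ.- ℤ.+ 1)) (geometric-* j)) (m*n/n≡m (geometric j) (b ℤ.- ℤ.+ 1))

    gauss-zero : gauss b 0 ≡ ℤ.+ 0
    gauss-zero = gauss≡geometric 0

    gauss-suc : ∀ j → gauss b (suc j) ≡ b ℤ.* gauss b j ℤ.+ ℤ.+ 1
    gauss-suc j = trans (gauss≡geometric (suc j)) (cong (λ g → b ℤ.* g ℤ.+ ℤ.+ 1) (sym (gauss≡geometric j)))

  -- Rational limits of Cauchy sequences

  infix 4 _⟶_

  -- Equalities of reals descend to ℚ through this relation: both sides are limits of one rational
  -- sequence, and `⟶-unique` identifies them.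
  record _⟶_ (x : ℕ → ℚ) (q : ℚ) : Set where
    constructor mk⟶
    field
      tail : ∀ ε → 0ℚ < ε → ∃[ N ] ∀ n → N ℕ.≤ n → ℚ.∣ x n - q ∣ ≤ ε

  open _⟶_

  private
    0<½* : ∀ {ε} → 0ℚ < ε → 0ℚ < ½ * ε
    0<½* = 0<* (ℚ.positive⁻¹ ½)

    ½+½ : ∀ ε → ½ * ε + ½ * ε ≡ ε
    ½+½ = solve 1 (λ e → con ½ :* e :+ con ½ :* e := e) refl

    ∣-∣-swap : ∀ p q → ℚ.∣ p - q ∣ ≡ ℚ.∣ q - p ∣
    ∣-∣-swap p q = trans (sym (ℚ.∣-p∣≡∣p∣ (p - q))) (cong ℚ.∣_∣ (solve 2 (λ p q → :- (p :- q) := q :- p) refl p q))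

  ⟶-+ : ∀ {x y p q} → x ⟶ p → y ⟶ q → (λ n → x n + y n) ⟶ p + q
  tail (⟶-+ {x} {y} {p} {q} hx hy) ε 0<ε with tail hx (½ * ε) (0<½* 0<ε) | tail hy (½ * ε) (0<½* 0<ε)
  ... | M , h | N , k = M ℕ.⊔ N , λ n ≤n → begin
    ℚ.∣ x n + y n - (p + q) ∣          ≡⟨ cong ℚ.∣_∣ (solve 4 (λ x y p q → x :+ y :- (p :+ q) := (x :- p) :+ (y :- q)) refl (x n) (y n) p q) ⟩
    ℚ.∣ (x n - p) + (y n - q) ∣        ≤⟨ ℚ.∣p+q∣≤∣p∣+∣q∣ (x n - p) (y n - q) ⟩
    ℚ.∣ x n - p ∣ + ℚ.∣ y n - q ∣      ≤⟨ ℚ.+-mono-≤ (h n (ℕ.m⊔n≤o⇒m≤o M N ≤n)) (k n (ℕ.m⊔n≤o⇒n≤o M N ≤n)) ⟩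
    ½ * ε + ½ * ε                      ≡⟨ ½+½ ε ⟩
    ε                                  ∎
    where open ℚ.≤-Reasoning

  ⟶-const : ∀ q → (λ _ → q) ⟶ q
  tail (⟶-const q) ε 0<ε = 0 , λ _ _ → subst (λ z → ℚ.∣ z ∣ ≤ ε) (sym (ℚ.+-inverseʳ q)) (ℚ.<⇒≤ 0<ε)

  ⟶-* : ∀ c {x q} → x ⟶ q → (λ n → c * x n) ⟶ c * q
  tail (⟶-* c {x} {q} hx) ε 0<ε with tail hx (ε * inv m) (0<* 0<ε (0<inv 0<m))
    where
    -- The summand 1 keeps the divisor positive when `c` is 0.
    m = 1ℚ + ℚ.∣ c ∣
    0<m : 0ℚ < m
    0<m = ℚ.+-mono-<-≤ 0<1 (ℚ.0≤∣p∣ c)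
  ... | N , h = N , λ n N≤n → begin
    ℚ.∣ c * x n - c * q ∣            ≡⟨ cong ℚ.∣_∣ (solve 3 (λ c x q → c :* x :- c :* q := c :* (x :- q)) refl c (x n) q) ⟩
    ℚ.∣ c * (x n - q) ∣              ≡⟨ ℚ.∣p*q∣≡∣p∣*∣q∣ c (x n - q) ⟩
    ℚ.∣ c ∣ * ℚ.∣ x n - q ∣          ≤⟨ ≤-from ℚ.∣ x n - q ∣ (ℚ.0≤∣p∣ (x n - q)) (solve 2 (λ c d → (con 1ℚ :+ c) :* d := c :* d :+ d) refl ℚ.∣ c ∣ ℚ.∣ x n - q ∣) ⟩
    m * ℚ.∣ x n - q ∣                ≤⟨ *-mono-≤ m (ℚ.<⇒≤ 0<m) (h n N≤n) ⟩
    m * (ε * inv m)                  ≡⟨ solve 3 (λ m e i → m :* (e :* i) := m :* i :* e) refl m ε (inv m) ⟩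
    m * inv m * ε                    ≡⟨ cong (_* ε) (*-inv 0<m) ⟩
    1ℚ * ε                           ≡⟨ ℚ.*-identityˡ ε ⟩
    ε                                ∎
    where
    open ℚ.≤-Reasoning
    m = 1ℚ + ℚ.∣ c ∣
    0<m : 0ℚ < m
    0<m = ℚ.+-mono-<-≤ 0<1 (ℚ.0≤∣p∣ c)

  ⟶-cong : ∀ {x y q} → (∀ n → x n ≡ y n) → x ⟶ q → y ⟶ q
  tail (⟶-cong {q = q} eq hx) ε 0<ε with tail hx ε 0<ε
  ... | N , h = N , λ n N≤n → subst (λ z → ℚ.∣ z - q ∣ ≤ ε) (eq n) (h n N≤n)

  ⟶-unique : ∀ {x p q} → x ⟶ p → x ⟶ q → p ≡ q
  ⟶-unique {x} {p} {q} hp hq = p-q≡0⇒p≡q (ℚ.∣p∣≡0⇒p≡0 (p - q) (ℚ.≤-antisym (ℚ.≮⇒≥ not<) (ℚ.0≤∣p∣ (p - q))))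
    where
    open ℚ.≤-Reasoning
    e = ℚ.∣ p - q ∣
    p-q≡0⇒p≡q : p - q ≡ 0ℚ → p ≡ q
    p-q≡0⇒p≡q eq = trans (solve 2 (λ p q → p := p :- q :+ q) refl p q) (trans (cong (_+ q) eq) (ℚ.+-identityˡ q))
    not< : ¬ (0ℚ < e)
    -- Quarters of the distance are used because closeness is non-strict: halves would only give e ≤
    -- e.
    not< 0<e with tail hp (½ * (½ * e)) (0<½* (0<½* 0<e)) | tail hq (½ * (½ * e)) (0<½* (0<½* 0<e))
    ... | M , h | N , k = ℚ.<-irrefl refl (begin-strict
      e                                ≡⟨ cong ℚ.∣_∣ (solve 3 (λ p q x → p :- q := (p :- x) :+ (x :- q)) refl p q (x n)) ⟩
      ℚ.∣ (p - x n) + (x n - q) ∣      ≤⟨ ℚ.∣p+q∣≤∣p∣+∣q∣ (p - x n) (x n - q) ⟩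
      ℚ.∣ p - x n ∣ + ℚ.∣ x n - q ∣    ≤⟨ ℚ.+-mono-≤ (subst (_≤ ½ * (½ * e)) (∣-∣-swap (x n) p) (h n (ℕ.m≤m⊔n M N))) (k n (ℕ.m≤n⊔m M N)) ⟩
      ½ * (½ * e) + ½ * (½ * e)        ≡⟨ ½+½ (½ * e) ⟩
      ½ * e                            <⟨ subst₂ _<_ (ℚ.+-identityʳ (½ * e)) (½+½ e) (ℚ.+-monoʳ-< (½ * e) (0<½* 0<e)) ⟩
      e                                ∎)
      where n = M ℕ.⊔ N

  ≈⇒⟶ : ∀ {x q} → fromℚ q ≈ x → seq x ⟶ q
  tail (≈⇒⟶ {x} {q} (mk≈ close)) ε 0<ε with close ε 0<ε
  ... | N , h = N , λ n N≤n → subst (_≤ ε) (∣-∣-swap q (seq x n)) (h n N≤n)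

  ≡⇒≈ : ∀ {x y} → (∀ n → seq x n ≡ seq y n) → x ≈ y
  ≡⇒≈ {x} {y} eq = mk≈ λ ε 0<ε → 0 , λ n _ →
    subst (λ z → ℚ.∣ z ∣ ≤ ε) (sym (trans (cong (_- seq y n) (eq n)) (ℚ.+-inverseʳ (seq y n)))) (ℚ.<⇒≤ 0<ε)

  seq-∑ : ∀ {m} (f : Fin m → ℝ) n → seq (∑ f) n ≡ ∑[ i ← allFin m ] seq (f i) n
  seq-∑ {zero}  f n = refl
  seq-∑ {suc m} f n = cong (seq (f Fin.zero) n +_) (trans (seq-∑ (f ∘ Fin.suc) n)
    (trans (sym (∑-map Fin.suc (allFin m) (λ i → seq (f i) n)))
           (cong (λ is → ∑[ i ← is ] seq (f i) n) (List.map-tabulate id Fin.suc))))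

  bounded : ∀ {n} (f : Fin n → ℕ) → ∃[ N ] ∀ i → f i ℕ.≤ N
  bounded {zero}  f = 0 , λ ()
  bounded {suc n} f with bounded (f ∘ Fin.suc)
  ... | N , h = f Fin.zero ℕ.⊔ N , λ
    { Fin.zero    → ℕ.m≤m⊔n (f Fin.zero) N
    ; (Fin.suc i) → ℕ.≤-trans (h i) (ℕ.m≤n⊔m (f Fin.zero) N) }

  ∣p∣≤q⇒p²≤q² : ∀ p q → ℚ.∣ p ∣ ≤ q → p * p ≤ q * q
  ∣p∣≤q⇒p²≤q² p q p≤q = subst (_≤ q * q) (trans (sym (ℚ.∣p*q∣≡∣p∣*∣q∣ p p)) (ℚ.0≤p⇒∣p∣≡p (0≤p² p)))
    (≤-from ((q - ℚ.∣ p ∣) * (q + ℚ.∣ p ∣)) (0≤* (0≤q-p p≤q) (0≤+ (ℚ.≤-trans (ℚ.0≤∣p∣ p) p≤q) (ℚ.0≤∣p∣ p)))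
      (solve 2 (λ p q → q :* q := p :* p :+ (q :- p) :* (q :+ p)) refl ℚ.∣ p ∣ q))

  -- Rational parameters and the bounds supplied by the SPLS property

  module Geometric (Γ : Graph) (dr : DistanceRegular Γ)
    (D : ℕ) (b : ℤ) .{{_ : ℤ.NonZero (b ℤ.- ℤ.+ 1)}} (α̂ β̂ : ℝ)
    (params : HasClassicalParameters dr D b α̂ β̂)
    (2≤b : ℤ.+ 2 ℤ.≤ b) (3≤D : 3 ℕ.≤ D)
    (s : ℕ) (spls : SPLS dr s)
    where

    open Graph Γ
    module I = DistanceRegular dr
    open HasClassicalParameters params using (diameter) renaming (b-eq to b-eqℝ; c-eq to c-eqℝ)
    open HasSPLS spls

    B : ℚ
    B = toℚ b

    [_] : ℕ → ℚ
    [ j ] = toℚ (gauss b j)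

    R : ℚ
    R = [ D ]

    2≤B : 2ℚ ≤ B
    2≤B = toℚ-mono-≤ (ℤ.+ 2) b 2≤b

    [0] : [ 0 ] ≡ 0ℚ
    [0] = cong toℚ (gauss-zero b)

    [suc] : ∀ j → [ suc j ] ≡ B * [ j ] + 1ℚ
    [suc] j = trans (cong toℚ (gauss-suc b j))
      (trans (toℚ-+ (b ℤ.* gauss b j) (ℤ.+ 1)) (cong (_+ 1ℚ) (toℚ-* b (gauss b j))))

    [1] : [ 1 ] ≡ 1ℚ
    [1] = trans ([suc] 0) (trans (cong (λ q → B * q + 1ℚ) [0]) (solve 1 (λ b → b :* con 0ℚ :+ con 1ℚ := con 1ℚ) refl B))

    [2] : [ 2 ] ≡ B + 1ℚ
    [2] = trans ([suc] 1) (trans (cong (λ q → B * q + 1ℚ) [1]) (cong (_+ 1ℚ) (ℚ.*-identityʳ B)))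

    0<D : 0 ℕ.< D
    0<D = ℕ.≤-trans (s≤s z≤n) 3≤D

    1<D : 1 ℕ.< D
    1<D = ℕ.≤-trans (s≤s (s≤s z≤n)) 3≤D

    open GaussianNumbers B [_] 2≤B [0] [suc]

    -- The real parameters are rational because k and c₂ are integers.
    α β : ℚ
    α = inv [ 2 ] * ℕtoℚ (I.c 2) - 1ℚ
    β = inv R * ℕtoℚ (I.b 0)

    private
      -- The formula for c₂ is solved for `α̂` termwise, so the sequence of `α̂` is an affine image
      -- of one that tends to the integer c₂.
      a⟶α : seq α̂ ⟶ α
      a⟶α = ⟶-cong eq (⟶-+ (⟶-* (inv [ 2 ]) (≈⇒⟶ (c-eqℝ 2 (s≤s z≤n) 1<D))) (⟶-const (- 1ℚ)))
        where
        eq : ∀ n → inv [ 2 ] * ([ 2 ] * (1ℚ + seq α̂ n * [ 1 ])) + - 1ℚ ≡ seq α̂ n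
        eq n = begin
          inv [ 2 ] * ([ 2 ] * (1ℚ + a * [ 1 ])) - 1ℚ
            ≡⟨ solve 4 (λ i q a o → i :* (q :* (con 1ℚ :+ a :* o)) :- con 1ℚ := q :* i :* (con 1ℚ :+ a :* o) :- con 1ℚ) refl (inv [ 2 ]) [ 2 ] a [ 1 ] ⟩
          [ 2 ] * inv [ 2 ] * (1ℚ + a * [ 1 ]) - 1ℚ   ≡⟨ cong₂ (λ p o → p * (1ℚ + a * o) - 1ℚ) (*-inv (0<[suc] 1)) [1] ⟩
          1ℚ * (1ℚ + a * 1ℚ) - 1ℚ                     ≡⟨ solve 1 (λ a → con 1ℚ :* (con 1ℚ :+ a :* con 1ℚ) :- con 1ℚ := a) refl a ⟩
          a ∎
          where
          open ≡-Reasoning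
          a = seq α̂ n

      b⟶β : seq β̂ ⟶ β
      b⟶β = ⟶-cong eq (⟶-* (inv R) (≈⇒⟶ (b-eqℝ 0 0<D)))
        where
        eq : ∀ n → inv R * ((R + - [ 0 ]) * (seq β̂ n + - (seq α̂ n * [ 0 ]))) ≡ seq β̂ n
        eq n = begin
          inv R * ((R - [ 0 ]) * (y - a * [ 0 ]))   ≡⟨ cong (λ q → inv R * ((R - q) * (y - a * q))) [0] ⟩
          inv R * ((R - 0ℚ) * (y - a * 0ℚ))         ≡⟨ solve 4 (λ i r y a → i :* ((r :- con 0ℚ) :* (y :- a :* con 0ℚ)) := r :* i :* y) refl (inv R) R y a ⟩
          R * inv R * y                             ≡⟨ cong (_* y) (*-inv (0<[] 0<D)) ⟩
          1ℚ * y                                    ≡⟨ ℚ.*-identityˡ y ⟩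
          y ∎
          where
          open ≡-Reasoning
          a = seq α̂ n
          y = seq β̂ n

    -- The sequence of the right-hand side tends both to `I.b i`, by hypothesis, and to the
    -- expression in the rational limits.
    b-eq : ∀ i → i ℕ.< D → ℕtoℚ (I.b i) ≡ ([ D ] - [ i ]) * (β - α * [ i ])
    b-eq i i<D = ⟶-unique (≈⇒⟶ (b-eqℝ i i<D))
      (⟶-cong (λ n → cong (λ t → (R - [ i ]) * t) (solve 3 (λ y a q → y :+ (:- q) :* a := y :- a :* q) refl (seq β̂ n) (seq α̂ n) [ i ]))
        (subst ((λ n → (R - [ i ]) * (seq β̂ n + (- [ i ]) * seq α̂ n)) ⟶_)
          (cong (λ t → (R - [ i ]) * t) (solve 3 (λ y a q → y :+ (:- q) :* a := y :- a :* q) refl β α [ i ]))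
          (⟶-* (R - [ i ]) (⟶-+ b⟶β (⟶-* (- [ i ]) a⟶α)))))

    c-eq : ∀ i → i ℕ.< D → ℕtoℚ (I.c (suc i)) ≡ [ suc i ] * (1ℚ + α * [ i ])
    c-eq i i<D = ⟶-unique (≈⇒⟶ (c-eqℝ (suc i) (s≤s z≤n) i<D))
      (⟶-cong (λ n → cong (λ t → [ suc i ] * (1ℚ + t)) (ℚ.*-comm [ i ] (seq α̂ n)))
        (subst ((λ n → [ suc i ] * (1ℚ + [ i ] * seq α̂ n)) ⟶_)
          (cong (λ t → [ suc i ] * (1ℚ + t)) (ℚ.*-comm [ i ] α))
          (⟶-* [ suc i ] (⟶-+ (⟶-const 1ℚ) (⟶-* [ i ] a⟶α)))))

    open Distances Γ dr D diameter
    open Classical Γ dr D diameter B α β [_] 2≤B [0] [suc] b-eq c-eq 0<D hiding (R)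

    -- `γ` stands for c₂ - 1, as `c₂≡` confirms.
    σ γ : ℚ
    σ = ℕtoℚ s
    γ = B + α * (B + 1ℚ)

    c₂≡ : ℕtoℚ (I.c 2) ≡ γ + 1ℚ
    c₂≡ = trans (c-eq 1 1<D) (trans (cong₂ (λ p o → p * (1ℚ + α * o)) [2] [1])
      (solve 2 (λ b a → (b :+ con 1ℚ) :* (con 1ℚ :+ a :* con 1ℚ) := b :+ a :* (b :+ con 1ℚ) :+ con 1ℚ) refl B α))

    -- c₃ > 0 gives c₂ > b.
    B+1≤c₂ : B + 1ℚ ≤ ℕtoℚ (I.c 2)
    B+1≤c₂ = subst (_≤ ℕtoℚ (I.c 2)) (trans (toℚ-+ (ℤ.+ 1) b) (ℚ.+-comm 1ℚ B))
      (toℚ-mono-≤ (ℤ.suc b) (ℤ.+ I.c 2) (ℤ.i<j⇒suc[i]≤j (toℚ-cancel-< b (ℤ.+ I.c 2) B<c₂)))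
      where
      B<c₂ : B < ℕtoℚ (I.c 2)
      B<c₂ = subst₂ _<_ (ℚ.+-identityʳ B)
        (trans (cong (λ q → B + (1ℚ + α * q)) [2]) (trans (solve 2 (λ b a → b :+ (con 1ℚ :+ a :* (b :+ con 1ℚ)) := b :+ a :* (b :+ con 1ℚ) :+ con 1ℚ) refl B α) (sym c₂≡)))
        (ℚ.+-monoʳ-< B (0<1+α[] 3≤D))

    -- Since c₂ = (b + 1)(1 + α), this is c₂ ≥ b + 1. The integrality of c₂ is essential: positivity
    -- of c₃ by itself bounds α only by - 1/(b + 1).
    0≤α : 0ℚ ≤ α
    0≤α = *-cancel-≤ (B + 1ℚ) (ℚ.<-≤-trans 0<1 (≤-from B 0≤B (ℚ.+-comm B 1ℚ)))
      (subst₂ _≤_ (sym (ℚ.*-zeroʳ (B + 1ℚ)))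
        (trans (cong (_- (B + 1ℚ)) c₂≡) (solve 2 (λ b a → b :+ a :* (b :+ con 1ℚ) :+ con 1ℚ :- (b :+ con 1ℚ) := (b :+ con 1ℚ) :* a) refl B α))
        (0≤q-p B+1≤c₂))

    2≤γ : 2ℚ ≤ γ
    2≤γ = ℚ.≤-trans 2≤B (≤-from (α * (B + 1ℚ)) (0≤* 0≤α (0≤+ 0≤B 0≤1)) refl)

    0≤γ : 0ℚ ≤ γ
    0≤γ = ℚ.≤-trans 0≤2 2≤γ

    a₁ : ℚ
    a₁ = β - 1ℚ + α * (R - 1ℚ)

    private
      toℚ-minus : ∀ y z → toℚ (y ℤ.- z) ≡ toℚ y - toℚ z
      toℚ-minus y z = trans (toℚ-+ y (ℤ.- z)) (cong (toℚ y +_) (toℚ-- z))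

    a₁≡ : toℚ (I.a 1) ≡ a₁
    a₁≡ = begin
      toℚ (I.a 1)
        ≡⟨ trans (toℚ-minus (ℤ.+ I.b 0 ℤ.- ℤ.+ I.b 1) (ℤ.+ I.c 1)) (cong (_- ℕtoℚ (I.c 1)) (toℚ-minus (ℤ.+ I.b 0) (ℤ.+ I.b 1))) ⟩
      ℕtoℚ (I.b 0) - ℕtoℚ (I.b 1) - ℕtoℚ (I.c 1)
        ≡⟨ cong₂ _-_ (cong₂ _-_ valency-eq (trans (b-eq 1 1<D) (cong (λ o → (R - o) * (β - α * o)) [1])))
                     (trans (c-eq 0 0<D) (cong₂ (λ o z → o * (1ℚ + α * z)) [1] [0])) ⟩
      R * β - (R - 1ℚ) * (β - α * 1ℚ) - 1ℚ * (1ℚ + α * 0ℚ)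
        ≡⟨ solve 3 (λ r β α → r :* β :- (r :- con 1ℚ) :* (β :- α :* con 1ℚ) :- con 1ℚ :* (con 1ℚ :+ α :* con 0ℚ)
             := β :- con 1ℚ :+ α :* (r :- con 1ℚ)) refl R β α ⟩
      a₁ ∎
      where open ≡-Reasoning

    a₁-large : (2ℚ * σ - 1ℚ) * γ ≤ a₁
    a₁-large = subst₂ _≤_
      (trans (toℚ-* (ℤ.+ 2 ℤ.* ℤ.+ s ℤ.- ℤ.+ 1) (ℤ.+ I.c 2 ℤ.- ℤ.+ 1)) (cong₂ _*_
        (trans (toℚ-minus (ℤ.+ 2 ℤ.* ℤ.+ s) (ℤ.+ 1)) (cong (_- 1ℚ) (toℚ-* (ℤ.+ 2) (ℤ.+ s))))
        (trans (toℚ-minus (ℤ.+ I.c 2) (ℤ.+ 1)) (trans (cong (_- 1ℚ) c₂≡) (solve 1 (λ g → g :+ con 1ℚ :- con 1ℚ := g) refl γ)))))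
      a₁≡
      (toℚ-mono-≤ _ _ a₁-bound)

    -- Inserting the bound on a₁ into the size condition leaves at least s γ + 2 vertices, and γ ≥
    -- 2.
    long : ∀ ℓ → SPLSLine dr (I.c 2) s ℓ → 2ℚ * σ + 1ℚ ≤ ℕtoℚ ∣ ℓ ∣
    long ℓ (_ , size) = ≤-from
      ((ℕtoℚ ∣ ℓ ∣ - (a₁ + 2ℚ - γ * (σ - 1ℚ))) + (a₁ - (2ℚ * σ - 1ℚ) * γ) + (σ * (γ - 2ℚ) + 1ℚ))
      (0≤+ (0≤+ (0≤q-p size′) (0≤q-p a₁-large)) (0≤+ (0≤* (0≤ℕtoℚ s) (0≤q-p 2≤γ)) 0≤1))
      (solve 4 (λ n a g s → n := con 2ℚ :* s :+ con 1ℚ :+ ((n :- (a :+ con 2ℚ :- g :* (s :- con 1ℚ)))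
          :+ (a :- (con 2ℚ :* s :- con 1ℚ) :* g) :+ (s :* (g :- con 2ℚ) :+ con 1ℚ))) refl (ℕtoℚ ∣ ℓ ∣) a₁ γ σ)
      where
      size′ : a₁ + 2ℚ - γ * (σ - 1ℚ) ≤ ℕtoℚ ∣ ℓ ∣
      size′ = subst (_≤ ℕtoℚ ∣ ℓ ∣)
        (trans (toℚ-minus (I.a 1 ℤ.+ ℤ.+ 2) ((ℤ.+ I.c 2 ℤ.- ℤ.+ 1) ℤ.* (ℤ.+ s ℤ.- ℤ.+ 1))) (cong₂ _-_
          (trans (toℚ-+ (I.a 1) (ℤ.+ 2)) (cong (_+ 2ℚ) a₁≡))
          (trans (toℚ-* (ℤ.+ I.c 2 ℤ.- ℤ.+ 1) (ℤ.+ s ℤ.- ℤ.+ 1)) (cong₂ _*_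
            (trans (toℚ-minus (ℤ.+ I.c 2) (ℤ.+ 1)) (trans (cong (_- 1ℚ) c₂≡) (solve 1 (λ g → g :+ con 1ℚ :- con 1ℚ := g) refl γ)))
            (toℚ-minus (ℤ.+ s) (ℤ.+ 1))))))
        (toℚ-mono-≤ _ (ℤ.+ ∣ ℓ ∣) size)

    -- Everything is reduced to the bound `main`, uniform in `i`: β - α[i] is at least β - αR, hence
    -- at least 2R(1 + α), and p(1 + α) ≥ 1 + αp ≥ 1 + αq because p ≥ 1 and p ≥ q.
    small : R ≤ σ → ∀ i → i ℕ.< D → 2ℚ * ((R - [ i ]) * (1ℚ + α * [ i ])) ≤ [ suc i ] * (β - α * [ i ])
    small R≤σ i i<D = ≤-from
      (p * ((β - α * R - 2ℚ * R * (1ℚ + α)) + α * (R - q)) + 2ℚ * R * ((p - 1ℚ) + α * (p - q)) + 2ℚ * q * (1ℚ + α * q))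
      (0≤+ (0≤+ (0≤* (0≤[] (suc i)) (0≤+ main (0≤* 0≤α (0≤R-[] (ℕ.<⇒≤ i<D)))))
                (0≤* (0≤* 0≤2 0≤R) (0≤+ (0≤q-p (1≤[suc] i)) (0≤* 0≤α (0≤q-p q≤p)))))
           (0≤* (0≤* 0≤2 (0≤[] i)) (ℚ.<⇒≤ (0<1+α[] i<D))))
      (solve 5 (λ r β α q p → p :* (β :- α :* q) := con 2ℚ :* ((r :- q) :* (con 1ℚ :+ α :* q)) :+
          (p :* ((β :- α :* r :- con 2ℚ :* r :* (con 1ℚ :+ α)) :+ α :* (r :- q)) :+
           con 2ℚ :* r :* ((p :- con 1ℚ) :+ α :* (p :- q)) :+ con 2ℚ :* q :* (con 1ℚ :+ α :* q))) refl R β α q p)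
      where
      q = [ i ]
      p = [ suc i ]
      q≤p : q ≤ p
      q≤p = ℚ.≤-trans (≤-from 1ℚ 0≤1 refl) ([]-suc i)
      -- With R ≤ s the bound on a₁ gives a₁ ≥ (2R - 1)γ, and b ≥ 2 gives γ ≥ 2 + 3α; the surplus is
      -- at least 1 + 2(R - 1)(1 + α).
      main : 0ℚ ≤ β - α * R - 2ℚ * R * (1ℚ + α)
      main = subst (0ℚ ≤_)
        (solve 5 (λ r β α B s →
          (β :- con 1ℚ :+ α :* (r :- con 1ℚ) :- (con 2ℚ :* s :- con 1ℚ) :* (B :+ α :* (B :+ con 1ℚ)))
          :+ con 2ℚ :* (s :- r) :* (B :+ α :* (B :+ con 1ℚ))
          :+ ((con 2ℚ :* (r :- con 1ℚ) :+ con 1ℚ) :* (B :- con 2ℚ) :* (con 1ℚ :+ α) :+ con 1ℚ :+ con 2ℚ :* (r :- con 1ℚ) :* (con 1ℚ :+ α))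
          := β :- α :* r :- con 2ℚ :* r :* (con 1ℚ :+ α)) refl R β α B σ)
        (0≤+ (0≤+ (0≤q-p a₁-large) (0≤* (0≤* 0≤2 (0≤q-p R≤σ)) 0≤γ))
          (0≤+ (0≤+ (0≤* (0≤* (0≤+ (0≤* 0≤2 0≤R-1) 0≤1) (0≤q-p 2≤B)) 0≤1+α) 0≤1) (0≤* (0≤* 0≤2 0≤R-1) 0≤1+α)))
        where
        0≤R-1 = 0≤q-p 1≤R
        0≤1+α = 0≤+ 0≤1 0≤α

    Line : Subset order → Set
    Line = SPLSLine dr (I.c 2) s

    clique : ∀ ℓ → Line ℓ → IsClique Γ ℓ
    clique ℓ l = proj₁ (proj₁ l)

    open Rigidity Γ dr D diameter B α β [_] 2≤B [0] [suc] b-eq c-eq 0<D Line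
      partial-linear point-graph s lines-through clique long small
      using (line-size; 0≤adjacency+R)

    -- The smallest eigenvalue and the Delsarte cliques

    adjacency-seq : ∀ x y n → seq (adjacency Γ x y) n ≡ adj x y
    adjacency-seq x y n with x ~? y
    ... | yes _ = refl
    ... | no  _ = refl

    θ : ℝ
    θ = fromℚ (- R)

    private
      ∑-adjacency : ∀ (w : V → ℝ) x n → seq (∑ (λ y → adjacency Γ x y ℝ.* w y)) n ≡ ∑[ y ← Vs ] (adj x y * seq (w y) n)
      ∑-adjacency w x n = trans (seq-∑ (λ y → adjacency Γ x y ℝ.* w y) n)
        (∑-cong Vs (λ y _ → cong (_* seq (w y) n) (adjacency-seq x y n)))

    θ-eigenvalue : IsEigenvalue Γ θ
    θ-eigenvalue = (λ y → fromℚ (u (d x y))) , (x , inj₂ (mk< (1ℚ , 0<1 , 0 , λ _ _ → ℚ.≤-reflexive (cong u (sym (d-refl x)))))) ,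
      λ y → ≡⇒≈ (λ n → trans (∑-adjacency (λ y → fromℚ (u (d x y))) y n) (u-eigen x y))
      where x = proj₁ (proj₂ diameter)

    -- Approximating an η-eigenvector w by rationals, with Σ (A w - η w)² small
    -- compared with (- R - η)² Σ w², contradicts the positivity of A + R I.
    θ-smallest : ∀ η → IsEigenvalue Γ η → θ ℝ.≤ η
    θ-smallest η (w , (x₁ , apart) , eig) (mk< (ε₁ , 0<ε₁ , N₁ , gap)) = ℚ.<-irrefl refl (begin-strict
      0ℚ
        ≤⟨ 0≤* 0≤2ε₁ (0≤adjacency+R v) ⟩
      2ℚ * ε₁ * (∑[ y ← Vs ] (v y * (R * v y + (∑[ z ← Vs ] (adj y z * v z)))))
        ≡⟨ sym (∑-* Vs (2ℚ * ε₁) (λ y → v y * (R * v y + (∑[ z ← Vs ] (adj y z * v z))))) ⟩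
      (∑[ y ← Vs ] (2ℚ * ε₁ * (v y * (R * v y + (∑[ z ← Vs ] (adj y z * v z))))))
        ≤⟨ ∑-mono Vs (λ y _ → pointwise y) ⟩
      (∑[ y ← Vs ] (ε * ε + (- (ε₁ * ε₁)) * (v y * v y)))
        ≡⟨ trans (∑-+ Vs (λ _ → ε * ε) (λ y → (- (ε₁ * ε₁)) * (v y * v y)))
             (cong₂ _+_ (∑-const Vs (ε * ε)) (∑-* Vs (- (ε₁ * ε₁)) (λ y → v y * v y))) ⟩
      ν * (ε * ε) + (- (ε₁ * ε₁)) * ∑′ Vs (λ y → v y * v y)
        ≤⟨ ≤-from (ε₁ * ε₁ * (∑′ Vs (λ y → v y * v y) - ε₂ * ε₂)) (0≤* (0≤p² ε₁) (0≤q-p ε₂²≤))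
             (solve 4 (λ n e S f → n :+ (:- e) :* f := n :+ (:- e) :* S :+ e :* (S :- f)) refl
               (ν * (ε * ε)) (ε₁ * ε₁) (∑′ Vs (λ y → v y * v y)) (ε₂ * ε₂)) ⟩
      ν * (ε * ε) + (- (ε₁ * ε₁)) * (ε₂ * ε₂)
        ≡⟨ trans (solve 4 (λ n e f g → n :* (e :* e) :+ (:- (f :* f)) :* (g :* g) := n :* (e :* e) :- (f :* g) :* (f :* g)) refl ν ε ε₁ ε₂)
             (cong (λ t → ν * (ε * ε) - t * t) (sym ε·m)) ⟩
      ν * (ε * ε) - (ε * m) * (ε * m)
        ≡⟨ solve 2 (λ n e → n :* (e :* e) :- (e :* (con 1ℚ :+ n)) :* (e :* (con 1ℚ :+ n)) := :- ((e :* e) :* (con 1ℚ :+ (n :* n :+ n)))) refl ν ε ⟩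
      - ((ε * ε) * (1ℚ + (ν * ν + ν)))
        <⟨ ℚ.neg-antimono-< (0<* (0<* 0<ε 0<ε) (ℚ.+-mono-<-≤ 0<1 (0≤+ (0≤p² ν) 0≤ν))) ⟩
      0ℚ ∎)
      where
      open ℚ.≤-Reasoning

      -- Passing to squares merges the two signs that apartness allows.
      away : w x₁ # 0ℝ → ∃[ ε₂ ] 0ℚ < ε₂ × ∃[ N ] ∀ n → N ℕ.≤ n → ε₂ * ε₂ ≤ seq (w x₁) n * seq (w x₁) n
      away (inj₁ (mk< (ε₂ , 0<ε₂ , N , h))) = ε₂ , 0<ε₂ , N , λ n N≤n →
        ≤-from ((0ℚ - (seq (w x₁) n + ε₂)) * (0ℚ - (seq (w x₁) n + ε₂) + 2ℚ * ε₂))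
          (0≤* (0≤q-p (h n N≤n)) (0≤+ (0≤q-p (h n N≤n)) (0≤* 0≤2 (ℚ.<⇒≤ 0<ε₂))))
          (solve 2 (λ w e → w :* w := e :* e :+ (con 0ℚ :- (w :+ e)) :* (con 0ℚ :- (w :+ e) :+ con 2ℚ :* e)) refl (seq (w x₁) n) ε₂)
      away (inj₂ (mk< (ε₂ , 0<ε₂ , N , h))) = ε₂ , 0<ε₂ , N , λ n N≤n →
        ≤-from ((seq (w x₁) n - (0ℚ + ε₂)) * (seq (w x₁) n - (0ℚ + ε₂) + 2ℚ * ε₂))
          (0≤* (0≤q-p (h n N≤n)) (0≤+ (0≤q-p (h n N≤n)) (0≤* 0≤2 (ℚ.<⇒≤ 0<ε₂))))
          (solve 2 (λ w e → w :* w := e :* e :+ (w :- (con 0ℚ :+ e)) :* (w :- (con 0ℚ :+ e) :+ con 2ℚ :* e)) refl (seq (w x₁) n) ε₂)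

      ε₂ = proj₁ (away apart)
      ν = ℕtoℚ (length Vs)
      0≤ν = 0≤ℕtoℚ (length Vs)
      m = 1ℚ + ν
      0<m = ℚ.+-mono-<-≤ 0<1 0≤ν
      -- Chosen so that ε(1 + ν) = ε₁ε₂; then even ν errors of size ε² stay below ε₁²ε₂².
      ε = ε₁ * ε₂ * inv m
      0<ε : 0ℚ < ε
      0<ε = 0<* (0<* 0<ε₁ (proj₁ (proj₂ (away apart)))) (0<inv 0<m)
      ε·m : ε * m ≡ ε₁ * ε₂
      ε·m = trans (solve 3 (λ e i m → e :* i :* m := m :* i :* e) refl (ε₁ * ε₂) (inv m) m)
                  (trans (cong (_* (ε₁ * ε₂)) (*-inv 0<m)) (ℚ.*-identityˡ (ε₁ * ε₂)))
      0≤2ε₁ : 0ℚ ≤ 2ℚ * ε₁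
      0≤2ε₁ = 0≤* 0≤2 (ℚ.<⇒≤ 0<ε₁)

      close : ∀ x → ∃[ N ] ∀ n → N ℕ.≤ n →
        ℚ.∣ seq (∑ (λ y → adjacency Γ x y ℝ.* w y)) n - seq η n * seq (w x) n ∣ ≤ ε
      close x = _≈_.close (eig x) ε 0<ε

      N₂ = proj₁ (proj₂ (proj₂ (away apart)))
      N₃ = proj₁ (bounded (proj₁ ∘ close))
      N = N₁ ℕ.⊔ (N₂ ℕ.⊔ N₃)
      N₁≤N = ℕ.m≤m⊔n N₁ (N₂ ℕ.⊔ N₃)
      N₂≤N = ℕ.≤-trans (ℕ.m≤m⊔n N₂ N₃) (ℕ.m≤n⊔m N₁ (N₂ ℕ.⊔ N₃))
      N₃≤N = ℕ.≤-trans (ℕ.m≤n⊔m N₂ N₃) (ℕ.m≤n⊔m N₁ (N₂ ℕ.⊔ N₃))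

      v : V → ℚ
      v y = seq (w y) N

      ε₂²≤ : ε₂ * ε₂ ≤ ∑′ Vs (λ y → v y * v y)
      ε₂²≤ = ℚ.≤-trans (proj₂ (proj₂ (proj₂ (away apart))) N N₂≤N)
        (≤∑ Vs {λ y → v y * v y} (λ y _ → 0≤p² (v y)) (∈-allFin x₁))

      -- With e = A v - η v at `y`, the gap bounds R + η by - ε₁, so the left side is at most 2ε₁ve
      -- - 2ε₁²v². The cross term is absorbed by 2ε₁ve ≤ ε₁²v² + e².
      pointwise : ∀ y → 2ℚ * ε₁ * (v y * (R * v y + (∑[ z ← Vs ] (adj y z * v z)))) ≤ ε * ε + (- (ε₁ * ε₁)) * (v y * v y)
      pointwise y = ≤-from
        ((ε * ε - e * e) + ((ε₁ * v y - e) * (ε₁ * v y - e) + 2ℚ * ε₁ * ((- R - (seq η N + ε₁)) * (v y * v y))))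
        (0≤+ (0≤q-p (∣p∣≤q⇒p²≤q² e ε e≤ε))
          (0≤+ (0≤p² (ε₁ * v y - e)) (0≤* 0≤2ε₁ (0≤* (0≤q-p (gap N N₁≤N)) (0≤p² (v y))))))
        (solve 6 (λ f ε v r S h → ε :* ε :+ (:- (f :* f)) :* (v :* v) := con 2ℚ :* f :* (v :* (r :* v :+ S)) :+
          ((ε :* ε :- (S :- h :* v) :* (S :- h :* v)) :+ ((f :* v :- (S :- h :* v)) :* (f :* v :- (S :- h :* v))
            :+ con 2ℚ :* f :* ((:- r :- (h :+ f)) :* (v :* v))))) refl ε₁ ε (v y) R S (seq η N))
        where
        S = ∑′ Vs (λ z → adj y z * v z)
        e = S - seq η N * v y
        e≤ε : ℚ.∣ e ∣ ≤ ε
        e≤ε = subst (λ t → ℚ.∣ t - seq η N * v y ∣ ≤ ε) (∑-adjacency w y N)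
          (proj₂ (close y) N (ℕ.≤-trans (proj₂ (bounded (proj₁ ∘ close)) y) N₃≤N))

    delsarte : ∀ ℓ → Line ℓ → IsDelsarteClique Γ dr ℓ
    delsarte ℓ l = clique ℓ l , θ , (θ-eigenvalue , θ-smallest) , fromℚ (inv R) ,
      ≡⇒≈ (λ _ → trans (solve 2 (λ r i → (:- (:- r)) :* i := r :* i) refl R (inv R)) (*-inv 0<R)) ,
      ≡⇒≈ (λ _ → trans (line-size ℓ l) (cong (1ℚ +_) (sym (begin
        ℕtoℚ (I.b 0) * inv R   ≡⟨ cong (_* inv R) valency-eq ⟩
        R * β * inv R          ≡⟨ solve 3 (λ r β i → r :* β :* i := r :* i :* β) refl R β (inv R) ⟩
        R * inv R * β          ≡⟨ cong (_* β) (*-inv 0<R) ⟩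
        1ℚ * β                 ≡⟨ ℚ.*-identityˡ β ⟩
        β                      ∎))))
      where open ≡-Reasoning

    geometric : IsGeometric Γ dr
    geometric = Line , delsarte , λ x y x~y →
      let x≢y , ℓ , l , x∈ , y∈ = Equivalence.to (point-graph x y) x~y
      in ℓ , (l , x∈ , y∈) , λ (m , x∈m , y∈m) → partial-linear x≢y l m x∈ y∈ x∈m y∈m

open import Data.Nat as ℕ using (ℕ)
open import Data.Integer as ℤ using (ℤ; +_)
open import Defs

theorem15 :
  (Γ : Graph) (dr : DistanceRegular Γ)
  (D : ℕ) (b : ℤ) .{{_ : ℤ.NonZero (b ℤ.- + 1)}} (α β : ℝ) →
  HasClassicalParameters dr D b α β →
  + 2 ℤ.≤ b → 3 ℕ.≤ D →
  (s : ℕ) → 1 ℕ.≤ s → SPLS dr s →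
  let r  = fromℤ (gauss b D)
      b′ = fromℤ b
      s′ = fromℕ s
      2ℝ = fromℕ 2
  in
  (b′ + 2ℝ) * (b′ + 1ℝ) * (s′ - 1ℝ) - (b′ * (b′ + 1ℝ) + r - 1ℝ) * α < β →
  ((b′ + 1ℝ) * (b′ * b′ + b′ + 1ℝ) - 2ℝ) * (s′ - b′) - α * (b′ + 1ℝ) * r + α * ((b′ + 1ℝ) * (b′ + 1ℝ)) < β →
  ((b′ + 1ℝ) * (b′ * b′ + b′ + 1ℝ) - 2ℝ + b′) * (s′ - b′) - α * (r - 1ℝ) + b′ * b′ - b′ < β →
  IsGeometric Γ dr
theorem15 Γ dr D b α β params 2≤b 3≤D s _ spls _ _ _ =
  Geometric.geometric Γ dr D b α β params 2≤b 3≤D s spls
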